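{- For all integers $n \geq 1$ and all real $x$ and $y$, \begin{align*} -\frac{B_n(x)}{n} & = \sum_{m=1}^n \sum_{l=1}^m \genfrac{\{}{\}}{0pt}{}{n-1}{m-1}_x\genfrac{\{}{\}}{0pt}{}{m-1}{l-1}_y c_m(x) c_{l-1}(y), \\ \frac{B_n(x)}{n} & = \sum_{m=1}^n \sum_{l=1}^m (-1)^m \genfrac{\{}{\}}{0pt}{}{n-1}{m-1}_x\genfrac{\{}{\}}{0pt}{}{m-1}{l-1}_y c_m(x) \widehat{c}_{l-1}(-y), \\ \frac{(-1)^n -B_n(x)}{n} & = \sum_{m=1}^n \sum_{l=1}^m \genfrac{\{}{\}}{0pt}{}{n-1}{m-1}_x\genfrac{\{}{\}}{0pt}{}{m-1}{l-1}_y \widehat{c}_m(-x) c_{l-1}(y), \\ \frac{B_n(x) - (-1)^n}{n} & = \sum_{m=1}^n \sum_{l=1}^m (-1)^m \genfrac{\{}{\}}{0pt}{}{n-1}{m-1}_x\genfrac{\{}{\}}{0pt}{}{m-1}{l-1}_y \widehat{c}_m(-x) \widehat{c}_{l-1}(-y), \end{align*} and \begin{align*} B_n(x) & = x^n - n\sum_{m=1}^n \sum_{l=1}^m \genfrac{\{}{\}}{0pt}{}{n-1}{m-1}_x\genfrac{\{}{\}}{0pt}{}{m-1}{l-1}_y c_m \, c_{l-1}(y), \\ B_n(x) & = x^n + n\sum_{m=1}^n \sum_{l=1}^m (-1)^m \genfrac{\{}{\}}{0pt}{}{n-1}{m-1}_x\genfrac{\{}{\}}{0pt}{}{m-1}{l-1}_y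 c_m \, \widehat{c}_{l-1}(-y), \\ B_n(x) & = (x-1)^n - n \sum_{m=1}^n \sum_{l=1}^m \genfrac{\{}{\}}{0pt}{}{n-1}{m-1}_x\genfrac{\{}{\}}{0pt}{}{m-1}{l-1}_y \widehat{c}_m \, c_{l-1}(y), \\ B_n(x) & = (x-1)^n + n \sum_{m=1}^n \sum_{l=1}^m (-1)^m \genfrac{\{}{\}}{0pt}{}{n-1}{m-1}_x\genfrac{\{}{\}}{0pt}{}{m-1}{l-1}_y \widehat{c}_m \, \widehat{c}_{l-1}(-y). \end{align*}
   Context: For real $z$ and integer $n\ge 0$, $\binom{z}{n} = \frac{z(z-1)\cdots(z-n+1)}{n!}$. The Cauchy polynomials of the first and second kind are $c_n(x) = n! \int_{0}^{1} \binom{t - x}{n}\, dt$ and $\widehat{c}_n(x) = n! \int_{0}^{1} \binom{x - t}{n}\, dt$, $n \ge 0$; the Cauchy numbers are $c_n = c_n(0)$ and $\widehat{c}_n=\widehat{c}_n(0)$. $B_n(x)$ are the classical Bernoulli polynomials, $\frac{te^{xt}}{e^t-1}=\sum_{n\ge0}B_n(x)\frac{t^n}{n!}$. The generalized Stirling numbers of the second kind are $\genfrac{\{}{\}}{0pt}{}{n}{m}_x = \sum_{i=0}^{n-m} \binom{n}{i}\genfrac{\{}{\}}{0pt}{}{n-i}{m} x^i$ for $0 \leq m \leq n$ and $x\in\mathbb{R}$, where $\genfrac{\{}{\}}{0pt}{}{n}{m}$ are the ordinary Stirling numbers of the second kind and $x^0=1$. -}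

module Defs where

open import Algebra.Apartness.Bundles using (HeytingField; HeytingCommutativeRing)
open import Algebra.Bundles using (CommutativeRing)
open import Data.Fin.Base using (zero; suc; toℕ; inject₁; fromℕ)
open import Data.Nat.Base as ℕ using (ℕ; zero; suc; NonZero; _∸_; _!)
open import Data.Nat.Combinatorics using (_C_)
open import Data.Nat.Properties using (_!≢0)
open import Data.Product.Base using (∃-syntax; _×_; _,_; proj₁)
open import Data.Sum.Base using (_⊎_; inj₂)
open import Data.Vec.Functional using (Vector)
open import Function.Bundles using (_⇔_; Equivalence)
open import Level using (Level; _⊔_) renaming (suc to lsuc)
open import Relation.Binary.Core using (Rel)
open import Relation.Binary.Structures using (IsStrictPartialOrder)
open import Relation.Nullary.Negation using (¬_)

-- The library has no real numbers, so ℝ is an arbitrary Cauchy-complete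
-- Archimedean ordered field; these axioms determine it up to isomorphism.
-- They are phrased with a strict order and apartness, so that they hold
-- constructively (for instance for Bishop's regular sequences of rationals).

record OrderedField a ℓ₁ ℓ₂ ℓ₃ : Set (lsuc (a ⊔ ℓ₁ ⊔ ℓ₂ ⊔ ℓ₃)) where
  infix 4 _<_ _≤_
  field
    heytingField : HeytingField a ℓ₁ ℓ₂

  open HeytingField heytingField public
    using (Carrier; _≈_; _#_; _+_; _*_; -_; _-_; 0#; 1#; #⇒invertible; heytingCommutativeRing)
  open HeytingCommutativeRing heytingCommutativeRing public
    using (commutativeRing)

  field
    _<_                  : Rel Carrier ℓ₃
    isStrictPartialOrder : IsStrictPartialOrder _≈_ _<_
    #⇔<⊎>                : ∀ {x y} → (x # y) ⇔ ((x < y) ⊎ (y < x))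
    0<1                  : 0# < 1#
    +-monoˡ-<            : ∀ {x y} z → x < y → (x + z) < (y + z)
    *-pos                : ∀ {x y} → 0# < x → 0# < y → 0# < (x * y)

  open CommutativeRing commutativeRing using (semiring)
  open import Algebra.Properties.Semiring.Mult semiring public
    using () renaming (_×_ to _×ℕ_)
  open import Algebra.Properties.Semiring.Exp semiring public
    using (_^_)
  open import Algebra.Properties.Semiring.Sum semiring public
    using (sum; sum-syntax; sum⁺-syntax)

  _≤_ : Rel Carrier ℓ₃
  x ≤ y = ¬ (y < x)

  -- ∣ x - y ∣ < ε
  Within : Carrier → Rel Carrier ℓ₃
  Within ε x y = (- ε < x - y) × (x - y < ε)

  IsCauchySequence : (ℕ → Carrier) → Set (a ⊔ ℓ₃)
  IsCauchySequence s = ∀ ε → 0# < ε → ∃[ N ] (∀ m n → N ℕ.≤ m → N ℕ.≤ n → Within ε (s m) (s n))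

  ConvergesTo : (ℕ → Carrier) → Carrier → Set (a ⊔ ℓ₃)
  ConvergesTo s x = ∀ ε → 0# < ε → ∃[ N ] (∀ n → N ℕ.≤ n → Within ε (s n) x)

record RealField a ℓ₁ ℓ₂ ℓ₃ : Set (lsuc (a ⊔ ℓ₁ ⊔ ℓ₂ ⊔ ℓ₃)) where
  field
    orderedField : OrderedField a ℓ₁ ℓ₂ ℓ₃

  open OrderedField orderedField public

  field
    archimedean : ∀ x → ∃[ n ] (x < n ×ℕ 1#)
    complete    : ∀ s → IsCauchySequence s → ∃[ x ] ConvergesTo s x

stirling₂ : ℕ → ℕ → ℕ
stirling₂ zero    zero    = 1
stirling₂ zero    (suc m) = 0
stirling₂ (suc n) zero    = 0
stirling₂ (suc n) (suc m) = suc m ℕ.* stirling₂ n (suc m) ℕ.+ stirling₂ n m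

module Real {a ℓ₁ ℓ₂ ℓ₃ : Level} (R : RealField a ℓ₁ ℓ₂ ℓ₃) where

  open RealField R public renaming (Carrier to ℝ)
  open CommutativeRing commutativeRing using (+-identityˡ; +-identityʳ; sym)
  open IsStrictPartialOrder isStrictPartialOrder
    using (<-respʳ-≈; <-respˡ-≈) renaming (trans to <-trans)

  infixl 7 _/ℕ_
  infixl 8 _⊛_
  infix 10 -1^_

  natℝ : ℕ → ℝ
  natℝ n = n ×ℕ 1#

  0<natℝ-suc : ∀ n → 0# < natℝ (suc n)
  0<natℝ-suc zero    = <-respʳ-≈ (sym (+-identityʳ 1#)) 0<1
  0<natℝ-suc (suc n) =
    <-trans (0<natℝ-suc n) (<-respˡ-≈ (+-identityˡ (natℝ (suc n))) (+-monoˡ-< (natℝ (suc n)) 0<1))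

  natℝ-#0 : ∀ n → .{{NonZero n}} → natℝ n # 0#
  natℝ-#0 (suc n) = Equivalence.from #⇔<⊎> (inj₂ (0<natℝ-suc n))

  -- #⇒invertible inverts the difference natℝ n - 0#.
  _/ℕ_ : ℝ → (n : ℕ) → .{{NonZero n}} → ℝ
  x /ℕ n = x * proj₁ (#⇒invertible (natℝ-#0 n))

  -1^_ : ℕ → ℝ
  -1^ n = (- 1#) ^ n

  ∑₁ : ℕ → (ℕ → ℝ) → ℝ
  ∑₁ n f = ∑[ i < n ] f (suc (toℕ i))

  syntax ∑₁ n (λ m → e) = ∑[1≤ m ≤ n ] e

  fallingFactorial : ℝ → ℕ → ℝ
  fallingFactorial z zero    = 1#
  fallingFactorial z (suc n) = fallingFactorial z n * (z - natℝ n)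

  binom : ℝ → ℕ → ℝ
  binom z n = (fallingFactorial z n /ℕ (n !)) {{n !≢0}}

  record TaggedPartition (lo hi : ℝ) (N : ℕ) : Set (a ⊔ ℓ₁ ⊔ ℓ₃) where
    field
      point   : Vector ℝ (suc N)
      tag     : Vector ℝ N
      start   : point zero ≈ lo
      end     : point (fromℕ N) ≈ hi
      left≤   : ∀ i → point (inject₁ i) ≤ tag i
      ≤right  : ∀ i → tag i ≤ point (suc i)

    width : Vector ℝ N
    width i = point (suc i) - point (inject₁ i)

    riemannSum : (ℝ → ℝ) → ℝ
    riemannSum f = ∑[ i < N ] (f (tag i) * width i)

  open TaggedPartition using (width; riemannSum)

  IsIntegral : (f : ℝ → ℝ) (lo hi I : ℝ) → Set (a ⊔ ℓ₁ ⊔ ℓ₃)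
  IsIntegral f lo hi I =
    ∀ ε → 0# < ε → ∃[ δ ] ((0# < δ) × (∀ {N} (P : TaggedPartition lo hi N) →
      (∀ i → width P i < δ) → Within ε (riemannSum P f) I))

  AreCauchyPolynomials₁ : (ℕ → ℝ → ℝ) → Set (a ⊔ ℓ₁ ⊔ ℓ₃)
  AreCauchyPolynomials₁ c =
    ∀ n x → ∃[ I ] (IsIntegral (λ t → binom (t - x) n) 0# 1# I × (c n x ≈ natℝ (n !) * I))

  AreCauchyPolynomials₂ : (ℕ → ℝ → ℝ) → Set (a ⊔ ℓ₁ ⊔ ℓ₃)
  AreCauchyPolynomials₂ ĉ =
    ∀ n x → ∃[ I ] (IsIntegral (λ t → binom (x - t) n) 0# 1# I × (ĉ n x ≈ natℝ (n !) * I))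

  -- Formal power series in t, given by their coefficients.
  Series : Set a
  Series = ℕ → ℝ

  _⊛_ : Series → Series → Series
  (f ⊛ g) n = ∑[ i ≤ n ] (f (toℕ i) * g (n ∸ toℕ i))

  _⊖_ : Series → Series → Series
  (f ⊖ g) n = f n - g n

  𝟙 : Series
  𝟙 zero    = 1#
  𝟙 (suc n) = 0#

  𝕥 : Series
  𝕥 zero    = 0#
  𝕥 (suc n) = 𝟙 n

  -- Σ sₙ tⁿ / n!
  egf : (ℕ → ℝ) → Series
  egf s n = (s n /ℕ (n !)) {{n !≢0}}

  -- exp x is e^{xt}
  exp : ℝ → Series
  exp x = egf (x ^_)

  -- The generating function t e^{xt} / (e^t - 1), with its denominator (which
  -- is not invertible, but not a zero divisor either) cleared.
  AreBernoulliPolynomials : (ℕ → ℝ → ℝ) → Set (a ⊔ ℓ₁)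
  AreBernoulliPolynomials B =
    ∀ x n → (𝕥 ⊛ exp x) n ≈ ((exp 1# ⊖ 𝟙) ⊛ egf (λ k → B k x)) n

  -- Meaningful for m ≤ n.
  stirling₂ˣ : ℝ → ℕ → ℕ → ℝ
  stirling₂ˣ x n m = ∑[ i ≤ n ∸ m ] (natℝ ((n C toℕ i) ℕ.* stirling₂ (n ∸ toℕ i) m) * x ^ toℕ i)

{-# OPTIONS --safe #-}

-- Identify the sequences B(x) = (B_n(x))_n and S_j = ({n, j})_n with their
-- exponential generating functions. Since j S_j = (e^t - 1) S_{j-1} and
-- (e^t - 1) B(x) = t e^{xt}, the number n {n-1, m-1}_x is m times the n-th entry
-- of B(x) S_m. If L is a linear functional on polynomials and C_m = L((z)_m) is its
-- value on falling factorials, then Σ_m {k, m} C_m = L(z^k), so for any weights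
-- T_m with m T_m = σ
--   n Σ_{m≥1} {n-1, m-1}_x C_m T_m = σ (L(B_n(x + z)) - B_n(x)).
-- The Cauchy polynomials are such C_m for z = ±t + w averaged over t ∈ [0, 1],
-- where L(e^{zt}) = (e^{(w'+1)t} - e^{w't}) / t with w' = w or w - 1, which gives
-- L(B_n(x + z)) = (x + w')^n; the inner sums over l are ±1/m by the same moments.
-- The integrals only enter as limits of uniform Riemann sums of powers.

module Submission where

open import Defs
open import Algebra.Apartness.Bundles using (HeytingField)
open import Algebra.Bundles using (CommutativeRing; RawRing)
import Algebra.Properties.AbelianGroup
import Algebra.Properties.CommutativeSemigroup
import Algebra.Properties.Group
import Algebra.Properties.Ring
import Algebra.Properties.Semiring.Exp
import Algebra.Properties.Semiring.Mult
import Algebra.Properties.Semiring.Mult.TCOptimised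
import Algebra.Properties.Semiring.Sum
import Algebra.Solver.Ring
open import Algebra.Solver.Ring.AlmostCommutativeRing
  using (fromCommutativeRing; _-Raw-AlmostCommutative⟶_; Induced-equivalence)
open import Data.Fin.Base using (toℕ)
open import Data.Fin.Properties using (toℕ<n; toℕ-inject₁; toℕ-fromℕ)
open import Data.Maybe.Base using (just; nothing)
open import Data.Nat.Base as ℕ using (ℕ; zero; suc; NonZero; _∸_; _!; z≤n; s≤s)
open import Data.Nat.Combinatorics
  using (_C_; nCk+nC[k+1]≡[n+1]C[k+1]; k>n⇒nCk≡0; nCk≡n!/k![n-k]!; k![n∸k]!∣n!)
open import Data.Nat.DivMod using (m/n*n≡m)
open import Data.Nat.Properties as ℕ using (_!≢0; _!*_!≢0)
open import Data.Product.Base using (∃-syntax; _×_; _,_; proj₁; proj₂)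
open import Data.Sum.Base using (_⊎_; inj₁; inj₂)
open import Function.Base using (_∘_)
open import Function.Bundles using (Equivalence)
open import Level using (Level)
open import Relation.Binary.Definitions using (WeaklyDecidable)
open import Relation.Binary.PropositionalEquality as ≡ using (_≡_)
open import Relation.Binary.Structures using (IsStrictPartialOrder)
open import Relation.Nullary.Decidable using (yes; no)
open import Relation.Nullary.Negation using (¬_; contradiction)

-- Neither t nor e^t - 1 is invertible, so identities between generating functions stay multiplied
-- through: the Bernoulli generating function trades e^t - 1 for t, and t alone is ever divided out,
-- as an index shift followed by cancelling a positive natural number. The arguments of the inner
-- sums are chosen so that y disappears: m T_m, before signs, is a difference of m-th powers of 1
-- and 0 for c(y), and of 0 and -1 for ĉ(-y). In the second case the factor (-1)^m of the statement
-- cancels the remaining sign, so m T_m does not depend on m. The outer sum then lacks only the term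
-- m = 0 of a full moment, and that term is B_n(x) because L(1) = 1. Falling factorials are never
-- integrated directly. They recombine into powers inside each Riemann sum, where a power is an
-- increment up to a second order error; only then is the limit taken. Since order is not decidable,
-- equality of limits comes from tightness of apartness.

-- A ring solver with integer coefficients

module IntegerCoefficients {c ℓ} (R : CommutativeRing c ℓ) where

  open CommutativeRing R
  open Algebra.Properties.Semiring.Mult semiring
    using (×-homo-+; ×1-homo-*; ×-congˡ) renaming (_×_ to _×ℕ_)
  open Algebra.Properties.Semiring.Mult.TCOptimised semiring
    using (×ᵤ≈×) renaming (_×_ to _×′_)
  open Algebra.Properties.Ring ring using (x[y-z]≈xy-xz; [y-z]x≈yx-zx; -0#≈0#)
  open Algebra.Properties.AbelianGroup +-abelianGroup using (⁻¹-anti-homo‿-; ⁻¹-∙-comm)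
  open Algebra.Properties.Group +-group using (x∙y⁻¹≈ε⇒x≈y; x≈y⇒x∙y⁻¹≈ε)
  open Algebra.Properties.CommutativeSemigroup +-commutativeSemigroup using (interchange)
  open import Relation.Binary.Reasoning.Setoid setoid

  -- (p , q) stands for the integer p - q. Normal forms are compared syntactically,
  -- so one of p and q is kept zero.
  canonical : ℕ × ℕ → ℕ × ℕ
  canonical (p , q) = p ∸ q , q ∸ p

  differences : RawRing _ _
  differences = record
    { Carrier = ℕ × ℕ
    ; _≈_     = _≡_
    ; _+_     = λ { (p , q) (r , s) → canonical (p ℕ.+ r , q ℕ.+ s) }
    ; _*_     = λ { (p , q) (r , s) → canonical (p ℕ.* r ℕ.+ q ℕ.* s , p ℕ.* s ℕ.+ q ℕ.* r) }
    ; -_      = λ { (p , q) → q , p }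
    ; 0#      = 0 , 0
    ; 1#      = 1 , 0
    }

  -- The clauses are chosen such that (0 , 0) and (1 , 0) evaluate to 0# and 1#
  -- definitionally.
  evaluate : ℕ × ℕ → Carrier
  evaluate (p , zero)  = p ×′ 1#
  evaluate (p , suc q) = p ×ℕ 1# - suc q ×ℕ 1#

  evaluate≈ : ∀ p q → evaluate (p , q) ≈ p ×ℕ 1# - q ×ℕ 1#
  evaluate≈ p zero    = begin
    p ×′ 1#         ≈⟨ ×ᵤ≈× p 1# ⟨
    p ×ℕ 1#         ≈⟨ +-identityʳ _ ⟨
    p ×ℕ 1# + 0#    ≈⟨ +-congˡ -0#≈0# ⟨
    p ×ℕ 1# - 0#    ∎
  evaluate≈ p (suc q) = refl

  [a-b]-[c-d]≈[a+d]-[b+c] : ∀ a b c d → (a - b) - (c - d) ≈ (a + d) - (b + c)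
  [a-b]-[c-d]≈[a+d]-[b+c] a b c d = begin
    (a - b) - (c - d)     ≈⟨ +-congˡ (⁻¹-anti-homo‿- c d) ⟩
    (a - b) + (d - c)     ≈⟨ interchange a (- b) d (- c) ⟩
    (a + d) + (- b - c)   ≈⟨ +-congˡ (⁻¹-∙-comm b c) ⟩
    (a + d) - (b + c)     ∎

  -- Integers are compared by cross-adding, which reduces everything to additivity of `_×ℕ_`.
  difference-cong : ∀ p q r s → p ℕ.+ s ≡ q ℕ.+ r → p ×ℕ 1# - q ×ℕ 1# ≈ r ×ℕ 1# - s ×ℕ 1#
  difference-cong p q r s eq =
    x∙y⁻¹≈ε⇒x≈y _ _ (trans ([a-b]-[c-d]≈[a+d]-[b+c] _ _ _ _) (x≈y⇒x∙y⁻¹≈ε (begin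
      p ×ℕ 1# + s ×ℕ 1#  ≈⟨ ×-homo-+ 1# p s ⟨
      (p ℕ.+ s) ×ℕ 1#    ≈⟨ ×-congˡ eq ⟩
      (q ℕ.+ r) ×ℕ 1#    ≈⟨ ×-homo-+ 1# q r ⟩
      q ×ℕ 1# + r ×ℕ 1#  ∎)))

  evaluate-canonical : ∀ p q → evaluate (canonical (p , q)) ≈ p ×ℕ 1# - q ×ℕ 1#
  evaluate-canonical p q =
    trans (evaluate≈ (p ∸ q) (q ∸ p)) (difference-cong (p ∸ q) (q ∸ p) p q (both≡⊔ p q))
    where
    both≡⊔ : ∀ p q → p ∸ q ℕ.+ q ≡ q ∸ p ℕ.+ p
    both≡⊔ zero    q       rewrite ℕ.0∸n≡0 q = ≡.sym (ℕ.+-identityʳ q)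
    both≡⊔ (suc p) zero    = ℕ.+-identityʳ (suc p)
    both≡⊔ (suc p) (suc q) =
      ≡.trans (ℕ.+-suc (p ∸ q) q) (≡.trans (≡.cong suc (both≡⊔ p q)) (≡.sym (ℕ.+-suc (q ∸ p) p)))

  evaluate-+ : ∀ x y → evaluate (RawRing._+_ differences x y) ≈ evaluate x + evaluate y
  evaluate-+ (p , q) (r , s) = begin
    evaluate (canonical (p ℕ.+ r , q ℕ.+ s))
      ≈⟨ evaluate-canonical (p ℕ.+ r) (q ℕ.+ s) ⟩
    (p ℕ.+ r) ×ℕ 1# - (q ℕ.+ s) ×ℕ 1#
      ≈⟨ +-cong (×-homo-+ 1# p r) (-‿cong (×-homo-+ 1# q s)) ⟩
    (p ×ℕ 1# + r ×ℕ 1#) - (q ×ℕ 1# + s ×ℕ 1#)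
      ≈⟨ +-congˡ (⁻¹-∙-comm _ _) ⟨
    (p ×ℕ 1# + r ×ℕ 1#) + (- (q ×ℕ 1#) - s ×ℕ 1#)
      ≈⟨ interchange _ _ _ _ ⟩
    (p ×ℕ 1# - q ×ℕ 1#) + (r ×ℕ 1# - s ×ℕ 1#)
      ≈⟨ +-cong (evaluate≈ p q) (evaluate≈ r s) ⟨
    evaluate (p , q) + evaluate (r , s)
      ∎

  evaluate-* : ∀ x y → evaluate (RawRing._*_ differences x y) ≈ evaluate x * evaluate y
  evaluate-* (p , q) (r , s) = begin
    evaluate (canonical (p ℕ.* r ℕ.+ q ℕ.* s , p ℕ.* s ℕ.+ q ℕ.* r))
      ≈⟨ evaluate-canonical (p ℕ.* r ℕ.+ q ℕ.* s) (p ℕ.* s ℕ.+ q ℕ.* r) ⟩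
    (p ℕ.* r ℕ.+ q ℕ.* s) ×ℕ 1# - (p ℕ.* s ℕ.+ q ℕ.* r) ×ℕ 1#
      ≈⟨ +-cong (homo p r q s) (-‿cong (homo p s q r)) ⟩
    (P * R′ + Q * S) - (P * S + Q * R′)
      ≈⟨ [a-b]-[c-d]≈[a+d]-[b+c] _ _ _ _ ⟨
    (P * R′ - P * S) - (Q * R′ - Q * S)
      ≈⟨ +-cong (x[y-z]≈xy-xz P R′ S) (-‿cong (x[y-z]≈xy-xz Q R′ S)) ⟨
    P * (R′ - S) - Q * (R′ - S)
      ≈⟨ [y-z]x≈yx-zx _ P Q ⟨
    (P - Q) * (R′ - S)
      ≈⟨ *-cong (evaluate≈ p q) (evaluate≈ r s) ⟨
    evaluate (p , q) * evaluate (r , s)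
      ∎
    where
    P = p ×ℕ 1#
    Q = q ×ℕ 1#
    R′ = r ×ℕ 1#
    S = s ×ℕ 1#
    homo : ∀ a b c d →
      (a ℕ.* b ℕ.+ c ℕ.* d) ×ℕ 1# ≈ (a ×ℕ 1#) * (b ×ℕ 1#) + (c ×ℕ 1#) * (d ×ℕ 1#)
    homo a b c d =
      trans (×-homo-+ 1# (a ℕ.* b) (c ℕ.* d)) (+-cong (×1-homo-* a b) (×1-homo-* c d))

  evaluate-- : ∀ x → evaluate (RawRing.-_ differences x) ≈ - evaluate x
  evaluate-- (p , q) = begin
    evaluate (q , p)         ≈⟨ evaluate≈ q p ⟩
    q ×ℕ 1# - p ×ℕ 1#        ≈⟨ ⁻¹-anti-homo‿- _ _ ⟨
    - (p ×ℕ 1# - q ×ℕ 1#)    ≈⟨ -‿cong (evaluate≈ p q) ⟨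
    - evaluate (p , q)       ∎

  morphism : differences -Raw-AlmostCommutative⟶ fromCommutativeRing R
  morphism = record
    { ⟦_⟧    = evaluate
    ; +-homo = evaluate-+
    ; *-homo = evaluate-*
    ; -‿homo = evaluate--
    ; 0-homo = refl
    ; 1-homo = refl
    }

  _≟_ : WeaklyDecidable (Induced-equivalence morphism)
  (p , q) ≟ (r , s) with p ℕ.+ s ℕ.≟ q ℕ.+ r
  ... | no  _  = nothing
  ... | yes eq = just (begin
    evaluate (p , q)     ≈⟨ evaluate≈ p q ⟩
    p ×ℕ 1# - q ×ℕ 1#    ≈⟨ difference-cong p q r s eq ⟩
    r ×ℕ 1# - s ×ℕ 1#    ≈⟨ evaluate≈ r s ⟨
    evaluate (r , s)     ∎)

  open Algebra.Solver.Ring differences (fromCommutativeRing R) morphism _≟_ public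
    using (solve; _:=_; _:+_; _:*_; _:-_; :-_; con; Polynomial)

  :0 :1 : ∀ {n} → Polynomial n
  :0 = con (0 , 0)
  :1 = con (1 , 0)

-- Products of exponential generating functions

module HurwitzProduct {c ℓ} (R : CommutativeRing c ℓ) where

  open CommutativeRing R
  open IntegerCoefficients R
  open Algebra.Properties.Semiring.Mult semiring
    using (×-homo-+; ×1-homo-*; ×-congˡ) renaming (_×_ to _×ℕ_)
  open Algebra.Properties.Semiring.Exp semiring using (_^_)
  open Algebra.Properties.Semiring.Sum semiring
  open import Relation.Binary.Reasoning.Setoid setoid

  Sequence : Set c
  Sequence = ℕ → Carrier

  nat : ℕ → Carrier
  nat n = n ×ℕ 1#

  Σ< : ℕ → Sequence → Carrier
  Σ< n f = ∑[ i < n ] f (toℕ i)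

  Σ<-cong-< : ∀ n {f g : Sequence} → (∀ k → k ℕ.< n → f k ≈ g k) → Σ< n f ≈ Σ< n g
  Σ<-cong-< n f≈g = sum-cong-≋ {n} (λ i → f≈g (toℕ i) (toℕ<n i))

  Σ<-cong : ∀ n {f g : Sequence} → (∀ k → f k ≈ g k) → Σ< n f ≈ Σ< n g
  Σ<-cong n f≈g = sum-cong-≋ {n} (λ i → f≈g (toℕ i))

  Σ<-distrib-+ : ∀ n (f g : Sequence) → Σ< n (λ k → f k + g k) ≈ Σ< n f + Σ< n g
  Σ<-distrib-+ n f g = ∑-distrib-+ {n} (f ∘ toℕ) (g ∘ toℕ)

  Σ<-zero : ∀ n (f : Sequence) → (∀ k → k ℕ.< n → f k ≈ 0#) → Σ< n f ≈ 0#
  Σ<-zero n f f≈0 = trans (Σ<-cong-< n f≈0) (sum-replicate-zero n)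

  Σ<-extend : ∀ {m n} (f : Sequence) → m ℕ.≤ n → (∀ k → m ℕ.≤ k → k ℕ.< n → f k ≈ 0#) →
              Σ< m f ≈ Σ< n f
  Σ<-extend {n = n} f z≤n f≈0 = sym (Σ<-zero n f (λ k → f≈0 k z≤n))
  Σ<-extend f (s≤s m≤n) f≈0 =
    +-congˡ (Σ<-extend (f ∘ suc) m≤n (λ k m≤k k<n → f≈0 (suc k) (s≤s m≤k) (s≤s k<n)))

  Σ<-*ˡ : ∀ n x (f : Sequence) → x * Σ< n f ≈ Σ< n (λ k → x * f k)
  Σ<-*ˡ n x f = *-distribˡ-sum {n} x (f ∘ toℕ)

  Σ<-*ʳ : ∀ n x (f : Sequence) → Σ< n f * x ≈ Σ< n (λ k → f k * x)
  Σ<-*ʳ n x f = *-distribʳ-sum {n} x (f ∘ toℕ)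

  -- Multiplication of exponential generating functions Σ aₙ tⁿ / n!, for which
  -- _∘ suc is differentiation; the recursion is the Leibniz rule.
  infixl 7 _⋆_
  _⋆_ : Sequence → Sequence → Sequence
  (a ⋆ b) zero    = a 0 * b 0
  (a ⋆ b) (suc n) = ((a ∘ suc) ⋆ b) n + (a ⋆ (b ∘ suc)) n

  -- The bound `k ≤ n` matters in `Σ<-moment`, where the two sequences are known to agree only up to
  -- `n`.
  ⋆-cong-≤ : ∀ n {a a′ b b′ : Sequence} →
             (∀ k → k ℕ.≤ n → a k ≈ a′ k) → (∀ k → k ℕ.≤ n → b k ≈ b′ k) →
             (a ⋆ b) n ≈ (a′ ⋆ b′) n
  ⋆-cong-≤ zero    p q = *-cong (p 0 z≤n) (q 0 z≤n)
  ⋆-cong-≤ (suc n) p q = +-cong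
    (⋆-cong-≤ n (λ k k≤n → p (suc k) (s≤s k≤n)) (λ k k≤n → q k (ℕ.m≤n⇒m≤1+n k≤n)))
    (⋆-cong-≤ n (λ k k≤n → p k (ℕ.m≤n⇒m≤1+n k≤n)) (λ k k≤n → q (suc k) (s≤s k≤n)))

  ⋆-cong : ∀ n {a a′ b b′ : Sequence} →
           (∀ k → a k ≈ a′ k) → (∀ k → b k ≈ b′ k) → (a ⋆ b) n ≈ (a′ ⋆ b′) n
  ⋆-cong n p q = ⋆-cong-≤ n (λ k _ → p k) (λ k _ → q k)

  ⋆-congˡ : ∀ n a {b b′ : Sequence} → (∀ k → b k ≈ b′ k) → (a ⋆ b) n ≈ (a ⋆ b′) n
  ⋆-congˡ n a = ⋆-cong n (λ _ → refl)

  ⋆-congʳ : ∀ n b {a a′ : Sequence} → (∀ k → a k ≈ a′ k) → (a ⋆ b) n ≈ (a′ ⋆ b) n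
  ⋆-congʳ n b p = ⋆-cong n p (λ _ → refl)

  ⋆-comm : ∀ n a b → (a ⋆ b) n ≈ (b ⋆ a) n
  ⋆-comm zero    a b = *-comm _ _
  ⋆-comm (suc n) a b =
    trans (+-comm _ _) (+-cong (⋆-comm n a (b ∘ suc)) (⋆-comm n (a ∘ suc) b))

  ⋆-distribˡ : ∀ n a b c → (a ⋆ (λ k → b k + c k)) n ≈ (a ⋆ b) n + (a ⋆ c) n
  ⋆-distribˡ zero    a b c = distribˡ _ _ _
  ⋆-distribˡ (suc n) a b c = begin
    (a ∘ suc ⋆ (λ k → b k + c k)) n + (a ⋆ (λ k → b (suc k) + c (suc k))) n
      ≈⟨ +-cong (⋆-distribˡ n (a ∘ suc) b c) (⋆-distribˡ n a (b ∘ suc) (c ∘ suc)) ⟩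
    ((a ∘ suc ⋆ b) n + (a ∘ suc ⋆ c) n) + ((a ⋆ b ∘ suc) n + (a ⋆ c ∘ suc) n)
      ≈⟨ solve 4 (λ p q r s → (p :+ q) :+ (r :+ s) := (p :+ r) :+ (q :+ s)) refl _ _ _ _ ⟩
    (a ⋆ b) (suc n) + (a ⋆ c) (suc n)
      ∎

  ⋆-distribʳ : ∀ n a b c → ((λ k → b k + c k) ⋆ a) n ≈ (b ⋆ a) n + (c ⋆ a) n
  ⋆-distribʳ n a b c = trans (⋆-comm n _ a)
    (trans (⋆-distribˡ n a b c) (+-cong (⋆-comm n a b) (⋆-comm n a c)))

  ⋆-scaleˡ : ∀ n x a b → (a ⋆ (λ k → x * b k)) n ≈ x * (a ⋆ b) n
  ⋆-scaleˡ zero    x a b = solve 3 (λ x a b → a :* (x :* b) := x :* (a :* b)) refl x (a 0) (b 0)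
  ⋆-scaleˡ (suc n) x a b =
    trans (+-cong (⋆-scaleˡ n x (a ∘ suc) b) (⋆-scaleˡ n x a (b ∘ suc))) (sym (distribˡ _ _ _))

  ⋆-scaleʳ : ∀ n x a b → ((λ k → x * b k) ⋆ a) n ≈ x * (b ⋆ a) n
  ⋆-scaleʳ n x a b = trans (⋆-comm n _ a) (trans (⋆-scaleˡ n x a b) (*-congˡ (⋆-comm n a b)))

  ⋆-zeroˡ : ∀ n a → ((λ _ → 0#) ⋆ a) n ≈ 0#
  ⋆-zeroˡ zero    a = zeroˡ _
  ⋆-zeroˡ (suc n) a = trans (+-cong (⋆-zeroˡ n a) (⋆-zeroˡ n (a ∘ suc))) (+-identityˡ 0#)

  -- Both sides have the derivative a'bc + ab'c + abc', so induction on `n` replaces any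
  -- manipulation of double binomial sums.
  ⋆-assoc : ∀ n a b c → ((a ⋆ b) ⋆ c) n ≈ (a ⋆ (b ⋆ c)) n
  ⋆-assoc zero    a b c = *-assoc _ _ _
  ⋆-assoc (suc n) a b c = begin
    ((a ⋆ b) ∘ suc ⋆ c) n + (a ⋆ b ⋆ c ∘ suc) n
      ≈⟨ +-congʳ (⋆-distribʳ n c (a ∘ suc ⋆ b) (a ⋆ b ∘ suc)) ⟩
    ((a ∘ suc ⋆ b ⋆ c) n + (a ⋆ b ∘ suc ⋆ c) n) + (a ⋆ b ⋆ c ∘ suc) n
      ≈⟨ +-cong (+-cong (⋆-assoc n (a ∘ suc) b c) (⋆-assoc n a (b ∘ suc) c)) (⋆-assoc n a b (c ∘ suc)) ⟩
    ((a ∘ suc ⋆ (b ⋆ c)) n + (a ⋆ (b ∘ suc ⋆ c)) n) + (a ⋆ (b ⋆ c ∘ suc)) n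
      ≈⟨ +-assoc _ _ _ ⟩
    (a ∘ suc ⋆ (b ⋆ c)) n + ((a ⋆ (b ∘ suc ⋆ c)) n + (a ⋆ (b ⋆ c ∘ suc)) n)
      ≈⟨ +-congˡ (⋆-distribˡ n a (b ∘ suc ⋆ c) (b ⋆ c ∘ suc)) ⟨
    (a ∘ suc ⋆ (b ⋆ c)) n + (a ⋆ (b ⋆ c) ∘ suc) n
      ∎

  ⋆-Σ< : ∀ n N a (b : ℕ → Sequence) (x : Sequence) →
         Σ< N (λ j → (a ⋆ b j) n * x j) ≈ (a ⋆ (λ k → Σ< N (λ j → b j k * x j))) n
  ⋆-Σ< n zero    a b x = sym (trans (⋆-comm n a _) (⋆-zeroˡ n a))
  ⋆-Σ< n (suc N) a b x = begin
    (a ⋆ b 0) n * x 0 + Σ< N (λ j → (a ⋆ b (suc j)) n * x (suc j))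
      ≈⟨ +-cong scale (⋆-Σ< n N a (b ∘ suc) (x ∘ suc)) ⟩
    (a ⋆ (λ k → b 0 k * x 0)) n + (a ⋆ (λ k → Σ< N (λ j → b (suc j) k * x (suc j)))) n
      ≈⟨ ⋆-distribˡ n a _ _ ⟨
    (a ⋆ (λ k → Σ< (suc N) (λ j → b j k * x j))) n
      ∎
    where
    scale : (a ⋆ b 0) n * x 0 ≈ (a ⋆ (λ k → b 0 k * x 0)) n
    scale = trans (*-comm _ _)
      (trans (sym (⋆-scaleˡ n (x 0) a (b 0))) (⋆-congˡ n a (λ k → *-comm _ _)))

  -- Pascal's rule splits the binomial sum into the two halves of the Leibniz recursion.
  ⋆-binomial : ∀ n a b → Σ< (suc n) (λ i → nat (n C i) * (a i * b (n ∸ i))) ≈ (a ⋆ b) n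
  ⋆-binomial zero    a b = solve 1 (λ x → (:1 :+ :0) :* x :+ :0 := x) refl (a 0 * b 0)
  ⋆-binomial (suc n) a b = begin
    t 0 + Σ< (suc n) (λ i → nat (suc n C suc i) * (a (suc i) * b (n ∸ i)))
      ≈⟨ +-congˡ (Σ<-cong (suc n) pascal) ⟩
    t 0 + Σ< (suc n) (λ i → u i + v (suc i))
      ≈⟨ +-congˡ (Σ<-distrib-+ (suc n) u (v ∘ suc)) ⟩
    -- `t 0` and `v 0` agree by computation, both binomial coefficients being 1.
    v 0 + (Σ< (suc n) u + Σ< (suc n) (v ∘ suc))
      ≈⟨ solve 3 (λ p q r → p :+ (q :+ r) := q :+ (p :+ r)) refl _ _ _ ⟩
    Σ< (suc n) u + Σ< (suc (suc n)) v
      ≈⟨ +-cong (⋆-binomial n (a ∘ suc) b) dropLast ⟩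
    (a ∘ suc ⋆ b) n + Σ< (suc n) v
      ≈⟨ +-congˡ (Σ<-cong-< (suc n) {v} shift) ⟩
    (a ∘ suc ⋆ b) n + Σ< (suc n) (λ i → nat (n C i) * (a i * b (suc (n ∸ i))))
      ≈⟨ +-congˡ (⋆-binomial n a (b ∘ suc)) ⟩
    (a ⋆ b) (suc n)
      ∎
    where
    t u v : Sequence
    t i = nat (suc n C i) * (a i * b (suc n ∸ i))
    u i = nat (n C i) * (a (suc i) * b (n ∸ i))
    v i = nat (n C i) * (a i * b (suc n ∸ i))
    pascal : ∀ i → nat (suc n C suc i) * (a (suc i) * b (n ∸ i)) ≈ u i + v (suc i)
    pascal i = trans
      (*-congʳ (trans (×-congˡ (≡.sym (nCk+nC[k+1]≡[n+1]C[k+1] n i))) (×-homo-+ 1# (n C i) (n C suc i))))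
      (distribʳ _ _ _)
    shift : ∀ i → i ℕ.< suc n → v i ≈ nat (n C i) * (a i * b (suc (n ∸ i)))
    shift i (s≤s i≤n) = *-congˡ (*-congˡ (reflexive (≡.cong b (ℕ.+-∸-assoc 1 i≤n))))
    dropLast : Σ< (suc (suc n)) v ≈ Σ< (suc n) v
    dropLast = sym (Σ<-extend v (ℕ.n≤1+n (suc n)) (λ k n<k _ →
      trans (*-congʳ {y = 0#} (×-congˡ (k>n⇒nCk≡0 n<k))) (zeroˡ _)))

  nCk*k!*[n∸k]! : ∀ {n k} → k ℕ.≤ n → n ! ≡ (n C k) ℕ.* (k ! ℕ.* (n ∸ k) !)
  nCk*k!*[n∸k]! {n} {k} k≤n = ≡.sym (≡.trans
    (≡.cong (ℕ._* (k ! ℕ.* (n ∸ k) !)) (nCk≡n!/k![n-k]! k≤n))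
    (m/n*n≡m {{k !* (n ∸ k) !≢0}} (k![n∸k]!∣n! k≤n)))

  -- Passes from ordinary coefficients to sequences scaled by k!. The scaling is a hypothesis about
  -- products, so the ring needs no division.
  ⋆-convolution : ∀ n (f g a b : Sequence) →
                  (∀ k → nat (k !) * f k ≈ a k) → (∀ k → nat (k !) * g k ≈ b k) →
                  nat (n !) * Σ< (suc n) (λ i → f i * g (n ∸ i)) ≈ (a ⋆ b) n
  ⋆-convolution n f g a b p q = begin
    nat (n !) * Σ< (suc n) (λ i → f i * g (n ∸ i))
      ≈⟨ Σ<-*ˡ (suc n) (nat (n !)) (λ i → f i * g (n ∸ i)) ⟩
    Σ< (suc n) (λ i → nat (n !) * (f i * g (n ∸ i)))
      ≈⟨ Σ<-cong-< (suc n) (λ { i (s≤s i≤n) → step i i≤n }) ⟩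
    Σ< (suc n) (λ i → nat (n C i) * (a i * b (n ∸ i)))
      ≈⟨ ⋆-binomial n a b ⟩
    (a ⋆ b) n
      ∎
    where
    step : ∀ i → i ℕ.≤ n → nat (n !) * (f i * g (n ∸ i)) ≈ nat (n C i) * (a i * b (n ∸ i))
    step i i≤n = begin
      nat (n !) * (f i * g (n ∸ i))
        ≈⟨ *-congʳ (×-congˡ (nCk*k!*[n∸k]! i≤n)) ⟩
      nat ((n C i) ℕ.* (i ! ℕ.* (n ∸ i) !)) * (f i * g (n ∸ i))
        ≈⟨ *-congʳ (trans (×1-homo-* (n C i) _) (*-congˡ (×1-homo-* (i !) _))) ⟩
      (nat (n C i) * (nat (i !) * nat ((n ∸ i) !))) * (f i * g (n ∸ i))
        ≈⟨ solve 5 (λ x y z u v → (x :* (y :* z)) :* (u :* v) := x :* ((y :* u) :* (z :* v)))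
             refl _ _ _ _ _ ⟩
      nat (n C i) * ((nat (i !) * f i) * (nat ((n ∸ i) !) * g (n ∸ i)))
        ≈⟨ *-congˡ (*-cong (p i) (q (n ∸ i))) ⟩
      nat (n C i) * (a i * b (n ∸ i))
        ∎

  -- In generating functions: 1, t and e^t - 1.
  δ τ e-1 : Sequence
  δ zero    = 1#
  δ (suc n) = 0#
  τ zero    = 0#
  τ (suc n) = δ n
  e-1 k = 1# ^ k - δ k

  ⋆-identityˡ : ∀ n a → (δ ⋆ a) n ≈ a n
  ⋆-identityˡ zero    a = *-identityˡ _
  ⋆-identityˡ (suc n) a =
    trans (+-cong (⋆-zeroˡ n a) (⋆-identityˡ n (a ∘ suc))) (+-identityˡ _)

  -- The factor `suc n` is the ratio of (n + 1)! and n!. Every factor n or m in the final identities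
  -- enters here, and t is cancelled by reading this backwards.
  τ-⋆ : ∀ n a → (τ ⋆ a) (suc n) ≈ nat (suc n) * a n
  τ-⋆ zero    a = solve 2 (λ x y → :1 :* x :+ :0 :* y := (:1 :+ :0) :* x) refl (a 0) (a 1)
  τ-⋆ (suc n) a = begin
    (δ ⋆ a) (suc n) + (τ ⋆ a ∘ suc) (suc n)   ≈⟨ +-cong (⋆-identityˡ (suc n) a) (τ-⋆ n (a ∘ suc)) ⟩
    a (suc n) + nat (suc n) * a (suc n)       ≈⟨ +-congʳ (*-identityˡ _) ⟨
    1# * a (suc n) + nat (suc n) * a (suc n)  ≈⟨ distribʳ _ _ _ ⟨
    nat (suc (suc n)) * a (suc n)             ∎

  ^-⋆-^ : ∀ n x y → ((x ^_) ⋆ (y ^_)) n ≈ (x + y) ^ n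
  ^-⋆-^ zero    x y = *-identityˡ 1#
  ^-⋆-^ (suc n) x y = begin
    ((λ k → x * x ^ k) ⋆ (y ^_)) n + ((x ^_) ⋆ (λ k → y * y ^ k)) n
      ≈⟨ +-cong (⋆-scaleʳ n x (y ^_) (x ^_)) (⋆-scaleˡ n y (x ^_) (y ^_)) ⟩
    x * ((x ^_) ⋆ (y ^_)) n + y * ((x ^_) ⋆ (y ^_)) n
      ≈⟨ distribʳ _ _ _ ⟨
    (x + y) * ((x ^_) ⋆ (y ^_)) n
      ≈⟨ *-congˡ (^-⋆-^ n x y) ⟩
    (x + y) ^ suc n
      ∎

  1^n≈1 : ∀ n → 1# ^ n ≈ 1#
  1^n≈1 zero    = refl
  1^n≈1 (suc n) = trans (*-identityˡ _) (1^n≈1 n)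

  e-1-suc : ∀ k → e-1 (suc k) ≈ e-1 k + δ k
  e-1-suc k = solve 2 (λ p d → :1 :* p :- :0 := (p :- d) :+ d) refl (1# ^ k) (δ k)

  e-1-⋆-^ : ∀ n w → (e-1 ⋆ (w ^_)) n + w ^ n ≈ (1# + w) ^ n
  e-1-⋆-^ n w = begin
    (e-1 ⋆ (w ^_)) n + w ^ n
      ≈⟨ +-congˡ (⋆-identityˡ n (w ^_)) ⟨
    (e-1 ⋆ (w ^_)) n + (δ ⋆ (w ^_)) n
      ≈⟨ ⋆-distribʳ n (w ^_) e-1 δ ⟨
    ((λ k → e-1 k + δ k) ⋆ (w ^_)) n
      ≈⟨ ⋆-congʳ n (w ^_) (λ k → solve 2 (λ p d → (p :- d) :+ d := p) refl (1# ^ k) (δ k)) ⟩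
    ((1# ^_) ⋆ (w ^_)) n
      ≈⟨ ^-⋆-^ n 1# w ⟩
    (1# + w) ^ n
      ∎

  -- Stirling numbers and moments

  stirling : ℕ → Sequence
  stirling j k = nat (stirling₂ k j)

  stirling-rec : ∀ j k → stirling (suc j) (suc k) ≈ nat (suc j) * stirling (suc j) k + stirling j k
  stirling-rec j k = trans (×-homo-+ 1# (suc j ℕ.* stirling₂ k (suc j)) (stirling₂ k j))
    (+-congʳ (×1-homo-* (suc j) (stirling₂ k (suc j))))

  stirling₂≡0 : ∀ {k j} → k ℕ.< j → stirling₂ k j ≡ 0
  stirling₂≡0 {zero}  {suc j} _ = ≡.refl
  stirling₂≡0 {suc k} {suc j} (s≤s k<j)
    rewrite stirling₂≡0 (ℕ.m<n⇒m<1+n k<j) | stirling₂≡0 k<j = ≡.cong (ℕ._+ 0) (ℕ.*-zeroʳ j)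

  -- Here S_j is (e^t - 1)^j / j!, but no power is formed. Both sides are differentiated, with (e^t
  -- - 1)' = (e^t - 1) + 1 and the Stirling recurrence in the form S_j' = j S_j + S_(j-1).
  stirling-⋆ : ∀ n j → (e-1 ⋆ stirling j) n ≈ nat (suc j) * stirling (suc j) n
  stirling-⋆ zero    j = solve 2 (λ s i → (:1 :- :1) :* s := i :* :0) refl (stirling j 0) (nat (suc j))
  stirling-⋆ (suc n) j = begin
    (e-1 ∘ suc ⋆ stirling j) n + rest j
      ≈⟨ +-congʳ (trans (⋆-congʳ n (stirling j) e-1-suc) (⋆-distribʳ n (stirling j) e-1 δ)) ⟩
    ((e-1 ⋆ stirling j) n + (δ ⋆ stirling j) n) + rest j
      ≈⟨ +-congʳ (+-cong (stirling-⋆ n j) (⋆-identityˡ n (stirling j))) ⟩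
    (nat (suc j) * stirling (suc j) n + stirling j n) + rest j
      ≈⟨ finish j ⟩
    nat (suc j) * (nat (suc j) * stirling (suc j) n + stirling j n)
      ≈⟨ *-congˡ (stirling-rec j n) ⟨
    nat (suc j) * stirling (suc j) (suc n)
      ∎
    where
    rest : ℕ → Carrier
    rest j = (e-1 ⋆ stirling j ∘ suc) n
    finish : ∀ j → (nat (suc j) * stirling (suc j) n + stirling j n) + rest j
                   ≈ nat (suc j) * (nat (suc j) * stirling (suc j) n + stirling j n)
    -- S_0 = 1 has derivative zero; the recurrence is available only from j = 1 on.
    finish zero    = trans (+-congˡ (trans (⋆-comm n e-1 _) (⋆-zeroˡ n e-1)))
      (solve 2 (λ s t → ((:1 :+ :0) :* s :+ t) :+ :0 := (:1 :+ :0) :* ((:1 :+ :0) :* s :+ t)) refl _ _)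
    finish (suc i) = begin
      A + rest (suc i)
        ≈⟨ +-congˡ (⋆-congˡ n e-1 (stirling-rec i)) ⟩
      A + (e-1 ⋆ (λ k → nat (suc i) * stirling (suc i) k + stirling i k)) n
        ≈⟨ +-congˡ (⋆-distribˡ n e-1 _ (stirling i)) ⟩
      A + ((e-1 ⋆ (λ k → nat (suc i) * stirling (suc i) k)) n + (e-1 ⋆ stirling i) n)
        ≈⟨ +-congˡ (+-cong
             (trans (⋆-scaleˡ n _ e-1 (stirling (suc i))) (*-congˡ (stirling-⋆ n (suc i))))
             (stirling-⋆ n i)) ⟩
      A + (nat (suc i) * (nat (suc (suc i)) * S₂) + nat (suc i) * S₁)
        ≈⟨ solve 3 (λ m s t → ((:1 :+ m) :* s :+ t) :+ (m :* ((:1 :+ m) :* s) :+ m :* t)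
             := (:1 :+ m) :* ((:1 :+ m) :* s :+ t)) refl (nat (suc i)) S₂ S₁ ⟩
      nat (suc (suc i)) * (nat (suc (suc i)) * S₂ + S₁)
        ∎
      where
      S₁ = stirling (suc i) n
      S₂ = stirling (suc (suc i)) n
      A = nat (suc (suc i)) * S₂ + S₁

  -- The umbral value L(z^k), if `x j` is L applied to the j-th falling factorial.
  moment : Sequence → Sequence
  moment x k = Σ< (suc k) (λ j → stirling j k * x j)

  -- Gives the moments up to `n` one common range, so that the sum over j can leave the product in
  -- `Σ<-moment`.
  moment-extend : ∀ {k n} x → k ℕ.≤ n → moment x k ≈ Σ< (suc n) (λ j → stirling j k * x j)
  moment-extend {k} x k≤n = Σ<-extend (λ j → stirling j k * x j) (s≤s k≤n) (λ j k<j _ →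
    trans (*-congʳ {y = 0#} (×-congˡ (stirling₂≡0 k<j))) (zeroˡ _))

  -- Induction by z (z)_j = (z)_(j+1) + j (z)_j, matched with the Stirling recurrence. `f` is given
  -- by its recursion because the ring is arbitrary here.
  moment-fallingFactorial : ∀ z (f : Sequence) → f 0 ≈ 1# → (∀ n → f (suc n) ≈ f n * (z - nat n)) →
                            ∀ k → moment f k ≈ z ^ k
  moment-fallingFactorial z f f₀ f₊ zero    =
    trans (+-congʳ (*-congˡ f₀)) (solve 0 ((:1 :+ :0) :* :1 :+ :0 := :1) refl)
  moment-fallingFactorial z f f₀ f₊ (suc k) = begin
    0# * f 0 + Σ< (suc k) (λ j → stirling (suc j) (suc k) * f (suc j))
      -- The vanishing first term is exchanged for `u 0`, also zero, so that the shifted sum of `u`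
      -- becomes a full one.
      ≈⟨ +-cong (trans (zeroˡ _) (sym (trans (*-congʳ (zeroˡ _)) (zeroˡ _))))
           (trans (Σ<-cong (suc k) split)
                  (Σ<-distrib-+ (suc k) (u ∘ suc) v)) ⟩
    u 0 + (Σ< (suc k) (u ∘ suc) + Σ< (suc k) v)
      ≈⟨ +-assoc _ _ _ ⟨
    Σ< (suc (suc k)) u + Σ< (suc k) v
      ≈⟨ +-congʳ (Σ<-extend u (ℕ.n≤1+n (suc k)) u-vanishes) ⟨
    Σ< (suc k) u + Σ< (suc k) v
      ≈⟨ Σ<-distrib-+ (suc k) u v ⟨
    Σ< (suc k) (λ j → u j + v j)
      ≈⟨ Σ<-cong (suc k) (λ j → trans (+-congˡ (*-congˡ (f₊ j))) (solve 4 (λ m s f z →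
           m :* s :* f :+ s :* (f :* (z :- m)) := z :* (s :* f)) refl (nat j) (stirling j k) (f j) z)) ⟩
    Σ< (suc k) (λ j → z * (stirling j k * f j))
      ≈⟨ Σ<-*ˡ (suc k) z (λ j → stirling j k * f j) ⟨
    z * moment f k
      ≈⟨ *-congˡ (moment-fallingFactorial z f f₀ f₊ k) ⟩
    z ^ suc k
      ∎
    where
    u v : Sequence
    u j = nat j * stirling j k * f j
    v j = stirling j k * f (suc j)
    split : ∀ j → stirling (suc j) (suc k) * f (suc j) ≈ u (suc j) + v j
    split j = trans (*-congʳ (stirling-rec j k)) (distribʳ _ _ _)
    u-vanishes : ∀ j → k ℕ.< j → j ℕ.< suc (suc k) → u j ≈ 0#
    u-vanishes j k<j _ =
      trans (*-congʳ (trans (*-congˡ {y = 0#} (×-congˡ (stirling₂≡0 k<j))) (zeroʳ _))) (zeroˡ _)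

  -- Umbrally Σ_j S_j (z)_j = e^{zt}, so the left side is a coefficient of a L(e^{zt}).
  Σ<-moment : ∀ n a x → Σ< (suc n) (λ j → (a ⋆ stirling j) n * x j) ≈ (a ⋆ moment x) n
  Σ<-moment n a x = trans (⋆-Σ< n (suc n) a stirling x)
    (⋆-cong-≤ n (λ _ _ → refl) (λ k k≤n → sym (moment-extend x k≤n)))

-- Order estimates and limits in the real field

module RiemannSums {a ℓ₁ ℓ₂ ℓ₃ : Level} (R : RealField a ℓ₁ ℓ₂ ℓ₃) where

  open Real R
  open CommutativeRing commutativeRing
    using ( refl; sym; trans; setoid; semiring; +-cong; +-congˡ; +-congʳ; *-congˡ; *-congʳ; -‿cong
          ; -‿inverseʳ; +-assoc; *-assoc; +-identityˡ; +-identityʳ; *-identityˡ; *-identityʳ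
          ; zeroˡ; distribˡ; distribʳ)
  open HeytingField heytingField using (tight; invertible⇒#)
  open IsStrictPartialOrder isStrictPartialOrder
    using (irrefl; <-respʳ-≈; <-respˡ-≈) renaming (trans to <-trans)
  open Algebra.Properties.Semiring.Sum semiring using (sum-cong-≋; ∑-comm)
  open Algebra.Properties.Semiring.Exp semiring using (^-congˡ)
  open Algebra.Properties.Semiring.Mult semiring using (×-homo-+; ×-congˡ)
  open IntegerCoefficients commutativeRing
  open HurwitzProduct commutativeRing
    using (Σ<; Σ<-cong; Σ<-*ˡ; Σ<-*ʳ; Σ<-distrib-+; moment; stirling; moment-fallingFactorial)
  open import Relation.Binary.Reasoning.Setoid setoid

  x<y⇒0<y-x : ∀ {x y} → x < y → 0# < y - x
  x<y⇒0<y-x {x} x<y = <-respˡ-≈ (-‿inverseʳ x) (+-monoˡ-< (- x) x<y)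

  0<d⇒x<y : ∀ {d x y} → 0# < d → d ≈ y - x → x < y
  0<d⇒x<y {d} {x} {y} 0<d d≈y-x = <-respʳ-≈
    (trans (+-congʳ d≈y-x) (solve 2 (λ x y → (y :- x) :+ x := y) refl x y))
    (<-respˡ-≈ (+-identityˡ x) (+-monoˡ-< x 0<d))

  0<x+y : ∀ {x y} → 0# < x → 0# < y → 0# < x + y
  0<x+y {x} {y} 0<x 0<y = <-trans 0<y (<-respˡ-≈ (+-identityˡ y) (+-monoˡ-< y 0<x))

  -- Being invertible, `y` is apart from 0 and so has a sign; a negative `y` would make 1 + x (0 -
  -- y) positive although it equals 0.
  0<inverse : ∀ {x y} → 0# < x → x * y ≈ 1# → 0# < y
  0<inverse {x} {y} 0<x xy≈1 with Equivalence.to #⇔<⊎> (invertible⇒# {y} {0#}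
    (x , trans (solve 2 (λ x y → x :* (y :- :0) := x :* y) refl x y) xy≈1
       , trans (solve 2 (λ x y → (y :- :0) :* x := x :* y) refl x y) xy≈1))
  ... | inj₂ 0<y = 0<y
  ... | inj₁ y<0 = contradiction (0<x+y 0<1 (*-pos 0<x (x<y⇒0<y-x y<0)))
    (irrefl (sym (begin
      1# + x * (0# - y)  ≈⟨ solve 2 (λ x y → :1 :+ x :* (:0 :- y) := :1 :- x :* y) refl x y ⟩
      1# - x * y         ≈⟨ +-congˡ (-‿cong xy≈1) ⟩
      1# - 1#            ≈⟨ -‿inverseʳ 1# ⟩
      0#                 ∎)))

  *-/ℕ : ∀ x n .{{_ : NonZero n}} → natℝ n * (x /ℕ n) ≈ x
  *-/ℕ x n = begin
    natℝ n * (x * i)         ≈⟨ solve 3 (λ n x i → n :* (x :* i) := x :* (i :* (n :- :0))) refl (natℝ n) x i ⟩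
    x * (i * (natℝ n - 0#))  ≈⟨ *-congˡ (proj₁ (proj₂ (#⇒invertible (natℝ-#0 n)))) ⟩
    x * 1#                   ≈⟨ *-identityʳ x ⟩
    x                        ∎
    where i = proj₁ (#⇒invertible (natℝ-#0 n))

  -- 1/(N + 1), such that x /ℕ suc N is x * step N definitionally.
  step : ℕ → ℝ
  step N = proj₁ (#⇒invertible (natℝ-#0 (suc N)))

  nat*step≈1 : ∀ N → natℝ (suc N) * step N ≈ 1#
  nat*step≈1 N = trans (*-congˡ (sym (*-identityˡ _))) (*-/ℕ 1# (suc N))

  0<step : ∀ N → 0# < step N
  0<step N = 0<inverse (0<natℝ-suc N) (nat*step≈1 N)

  nat-cancelˡ : ∀ n {x y} → natℝ (suc n) * x ≈ natℝ (suc n) * y → x ≈ y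
  nat-cancelˡ n {x} {y} eq = begin
    x                           ≈⟨ inverse x ⟨
    step n * (natℝ (suc n) * x) ≈⟨ *-congˡ eq ⟩
    step n * (natℝ (suc n) * y) ≈⟨ inverse y ⟩
    y                           ∎
    where
    inverse : ∀ x → step n * (natℝ (suc n) * x) ≈ x
    inverse x = trans (solve 3 (λ s n x → s :* (n :* x) := (n :* s) :* x) refl (step n) (natℝ (suc n)) x)
      (trans (*-congʳ (nat*step≈1 n)) (*-identityˡ x))

  half : ℝ → ℝ
  half x = x * step 1

  half+half : ∀ x → half x + half x ≈ x
  half+half x = trans (solve 2 (λ x s → x :* s :+ x :* s := x :* ((:1 :+ (:1 :+ :0)) :* s)) refl x (step 1))
    (trans (*-congˡ (nat*step≈1 1)) (*-identityʳ x))

  0<half : ∀ {x} → 0# < x → 0# < half x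
  0<half 0<x = *-pos 0<x (0<step 1)

  -- Says |x| < b without an absolute value; `Within ε x y` is `Bounded ε (x - y)` by definition.
  Bounded : ℝ → ℝ → Set ℓ₃
  Bounded b x = (- b < x) × (x < b)

  -- In terms of `b + x` and `b - x`, estimates become ring identities that express one positive
  -- quantity through others.
  Bounded-from : ∀ {b x} → 0# < b + x → 0# < b - x → Bounded b x
  Bounded-from {b} {x} p q =
    0<d⇒x<y p (solve 2 (λ b x → b :+ x := x :- (:- b)) refl b x) , 0<d⇒x<y q refl

  Bounded-lower : ∀ {b x} → Bounded b x → 0# < b + x
  Bounded-lower {b} {x} (p , _) =
    <-respʳ-≈ (solve 2 (λ b x → x :- (:- b) := b :+ x) refl b x) (x<y⇒0<y-x p)

  Bounded-upper : ∀ {b x} → Bounded b x → 0# < b - x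
  Bounded-upper (_ , q) = x<y⇒0<y-x q

  Bounded-cong : ∀ {b b′ x x′} → b ≈ b′ → x ≈ x′ → Bounded b x → Bounded b′ x′
  Bounded-cong b≈b′ x≈x′ (p , q) =
    <-respˡ-≈ (-‿cong b≈b′) (<-respʳ-≈ x≈x′ p) , <-respˡ-≈ x≈x′ (<-respʳ-≈ b≈b′ q)

  Bounded-weaken : ∀ {b b′ x} → b < b′ → Bounded b x → Bounded b′ x
  Bounded-weaken {b} {b′} {x} b<b′ bx = Bounded-from
    (<-respʳ-≈ (solve 3 (λ b b′ x → (b′ :- b) :+ (b :+ x) := b′ :+ x) refl b b′ x)
      (0<x+y (x<y⇒0<y-x b<b′) (Bounded-lower bx)))
    (<-respʳ-≈ (solve 3 (λ b b′ x → (b′ :- b) :+ (b :- x) := b′ :- x) refl b b′ x)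
      (0<x+y (x<y⇒0<y-x b<b′) (Bounded-upper bx)))

  Bounded-0 : ∀ {b} → 0# < b → Bounded b 0#
  Bounded-0 {b} 0<b = Bounded-from
    (<-respʳ-≈ (sym (+-identityʳ b)) 0<b) (<-respʳ-≈ (solve 1 (λ b → b := b :- :0) refl b) 0<b)

  Bounded-+ : ∀ {b x c y} → Bounded b x → Bounded c y → Bounded (b + c) (x + y)
  Bounded-+ {b} {x} {c} {y} bx cy = Bounded-from
    (<-respʳ-≈ (solve 4 (λ b x c y → (b :+ x) :+ (c :+ y) := (b :+ c) :+ (x :+ y)) refl b x c y)
      (0<x+y (Bounded-lower bx) (Bounded-lower cy)))
    (<-respʳ-≈ (solve 4 (λ b x c y → (b :- x) :+ (c :- y) := (b :+ c) :- (x :+ y)) refl b x c y)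
      (0<x+y (Bounded-upper bx) (Bounded-upper cy)))

  Bounded-neg : ∀ {b x} → Bounded b x → Bounded b (- x)
  Bounded-neg {b} {x} bx = Bounded-from (Bounded-upper bx)
    (<-respʳ-≈ (solve 2 (λ b x → b :+ x := b :- (:- x)) refl b x) (Bounded-lower bx))

  0<x+x⇒0<x : ∀ {x} → 0# < x + x → 0# < x
  0<x+x⇒0<x {x} 0<x+x = <-respʳ-≈ (trans (distribʳ _ _ _) (half+half x)) (0<half 0<x+x)

  -- 2 (b c - x y) = (b - x) (c + y) + (b + x) (c - y)
  Bounded-* : ∀ {b x c y} → Bounded b x → Bounded c y → Bounded (b * c) (x * y)
  Bounded-* {b} {x} {c} {y} bx cy = Bounded-from
    (0<x+x⇒0<x (<-respʳ-≈
      (solve 4 (λ b x c y → (b :- x) :* (c :- y) :+ (b :+ x) :* (c :+ y)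
        := (b :* c :+ x :* y) :+ (b :* c :+ x :* y)) refl b x c y)
      (0<x+y (*-pos (Bounded-upper bx) (Bounded-upper cy)) (*-pos (Bounded-lower bx) (Bounded-lower cy)))))
    (0<x+x⇒0<x (<-respʳ-≈
      (solve 4 (λ b x c y → (b :- x) :* (c :+ y) :+ (b :+ x) :* (c :- y)
        := (b :* c :- x :* y) :+ (b :* c :- x :* y)) refl b x c y)
      (0<x+y (*-pos (Bounded-upper bx) (Bounded-lower cy)) (*-pos (Bounded-lower bx) (Bounded-upper cy)))))

  Bounded-scale : ∀ {b x c} → 0# < c → Bounded b x → Bounded (c * b) (c * x)
  Bounded-scale {b} {x} {c} 0<c bx = Bounded-from
    (<-respʳ-≈ (distribˡ c b x) (*-pos 0<c (Bounded-lower bx)))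
    (<-respʳ-≈ (solve 3 (λ b x c → c :* (b :- x) := c :* b :- c :* x) refl b x c)
      (*-pos 0<c (Bounded-upper bx)))

  bounded : ∀ x → ∃[ b ] Bounded b x
  bounded x with archimedean x | archimedean (- x)
  -- Adding the two bounds avoids comparing them, and the extra ones give positive summands whether
  -- or not `m` or `n` is zero.
  ... | m , x<m | n , -x<n = (1# + natℝ m) + (1# + natℝ n) , Bounded-from
    (<-respʳ-≈ (solve 3 (λ x m n → (:1 :+ (:1 :+ m)) :+ (n :- (:- x)) := ((:1 :+ m) :+ (:1 :+ n)) :+ x)
        refl x (natℝ m) (natℝ n))
      (0<x+y (0<x+y 0<1 (0<natℝ-suc m)) (x<y⇒0<y-x -x<n)))
    (<-respʳ-≈ (solve 3 (λ x m n → (:1 :+ (:1 :+ n)) :+ (m :- x) := ((:1 :+ m) :+ (:1 :+ n)) :- x)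
        refl x (natℝ m) (natℝ n))
      (0<x+y (0<x+y 0<1 (0<natℝ-suc n)) (x<y⇒0<y-x x<m)))

  -- If `x` and `y` were apart, the bound taken at their own distance would contradict
  -- irreflexivity. The form `ε + ε` is what two approximations within `ε` produce.
  small⇒≈ : ∀ {x y} → (∀ ε → 0# < ε → Bounded (ε + ε) (x - y)) → x ≈ y
  small⇒≈ {x} {y} small = proj₁ (tight x y) (λ x#y → absurd (Equivalence.to #⇔<⊎> x#y))
    where
    within : ∀ {ε} → 0# < ε → Bounded ε (x - y)
    within {ε} 0<ε = Bounded-cong (half+half ε) refl (small (half ε) (0<half 0<ε))
    absurd : ¬ ((x < y) ⊎ (y < x))
    absurd (inj₁ x<y) = irrefl (solve 2 (λ x y → :- (y :- x) := x :- y) refl x y)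
      (proj₁ (within (x<y⇒0<y-x x<y)))
    absurd (inj₂ y<x) = irrefl refl (proj₂ (within (x<y⇒0<y-x y<x)))

  small-multiple : ∀ K ε → 0# < ε → ∃[ N₀ ] (∀ N → N₀ ℕ.≤ N → K * step N < ε)
  small-multiple K ε 0<ε = N₀ , bound
    where
    inverse = #⇒invertible (Equivalence.from #⇔<⊎> (inj₂ 0<ε))
    v = proj₁ inverse
    -- `v` is 1/ε, so `N₀` exceeds K/ε.
    N₀ = proj₁ (archimedean (K * v))
    Kv<N₀ = proj₂ (archimedean (K * v))
    bound : ∀ N → N₀ ℕ.≤ N → K * step N < ε
    bound N N₀≤N = 0<d⇒x<y (*-pos (*-pos 0<ε (0<step N)) 0<N+1-Kv) (begin
      ε * step N * (natℝ (suc N) - K * v)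
        ≈⟨ solve 5 (λ e s n k v → e :* s :* (n :- k :* v)
             := e :* (n :* s) :- k :* s :* (v :* (e :- :0))) refl ε (step N) (natℝ (suc N)) K v ⟩
      ε * (natℝ (suc N) * step N) - K * step N * (v * (ε - 0#))
        ≈⟨ +-cong (*-congˡ (nat*step≈1 N)) (-‿cong (*-congˡ (proj₁ (proj₂ inverse)))) ⟩
      ε * 1# - K * step N * 1#
        ≈⟨ +-cong (*-identityʳ _) (-‿cong (*-identityʳ _)) ⟩
      ε - K * step N
        ∎)
      where
      split : natℝ (N ∸ N₀) + natℝ N₀ ≈ natℝ N
      split = trans (sym (×-homo-+ 1# (N ∸ N₀) N₀)) (×-congˡ (ℕ.m∸n+n≡m N₀≤N))
      0<N+1-Kv : 0# < natℝ (suc N) - K * v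
      0<N+1-Kv = <-respʳ-≈
        (trans (solve 3 (λ p q r → (:1 :+ p) :+ (q :- r) := (:1 :+ (p :+ q)) :- r) refl
                 (natℝ (N ∸ N₀)) (natℝ N₀) (K * v))
               (+-congʳ (+-congˡ split)))
        (0<x+y (0<natℝ-suc (N ∸ N₀)) (x<y⇒0<y-x Kv<N₀))

  ConvergesTo-unique : ∀ {s x y} → ConvergesTo s x → ConvergesTo s y → x ≈ y
  ConvergesTo-unique {s} {x} {y} s→x s→y = small⇒≈ λ ε 0<ε →
    let M , p = s→x ε 0<ε
        N , q = s→y ε 0<ε
        n = M ℕ.⊔ N
    in Bounded-cong refl
      (solve 3 (λ s x y → (:- (s :- x)) :+ (s :- y) := x :- y) refl (s n) x y)
      (Bounded-+ (Bounded-neg (p n (ℕ.m≤m⊔n M N))) (q n (ℕ.m≤n⊔m M N)))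

  ConvergesTo-cong : ∀ {s t x y} → (∀ n → s n ≈ t n) → x ≈ y → ConvergesTo s x → ConvergesTo t y
  ConvergesTo-cong s≈t x≈y s→x ε 0<ε =
    let N , p = s→x ε 0<ε
    in N , λ n N≤n → Bounded-cong refl (+-cong (s≈t n) (-‿cong x≈y)) (p n N≤n)

  ConvergesTo-const : ∀ x → ConvergesTo (λ _ → x) x
  ConvergesTo-const x ε 0<ε = 0 , λ n _ → Bounded-cong refl (sym (-‿inverseʳ x)) (Bounded-0 0<ε)

  ConvergesTo-+ : ∀ {s t x y} → ConvergesTo s x → ConvergesTo t y → ConvergesTo (λ n → s n + t n) (x + y)
  ConvergesTo-+ {s} {t} {x} {y} s→x t→y ε 0<ε =
    let M , p = s→x (half ε) (0<half 0<ε)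
        N , q = t→y (half ε) (0<half 0<ε)
    in M ℕ.⊔ N , λ n M⊔N≤n → Bounded-cong (half+half ε)
      (solve 4 (λ s t x y → (s :- x) :+ (t :- y) := (s :+ t) :- (x :+ y)) refl (s n) (t n) x y)
      (Bounded-+ (p n (ℕ.≤-trans (ℕ.m≤m⊔n M N) M⊔N≤n)) (q n (ℕ.≤-trans (ℕ.m≤n⊔m M N) M⊔N≤n)))

  -- Only Stirling numbers, factorials and `suc k` have to pass through a limit, so repeated
  -- addition suffices.
  ConvergesTo-nat* : ∀ k {s x} → ConvergesTo s x → ConvergesTo (λ n → natℝ k * s n) (natℝ k * x)
  ConvergesTo-nat* zero    s→x = ConvergesTo-cong (λ n → sym (zeroˡ _)) (sym (zeroˡ _)) (ConvergesTo-const 0#)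
  ConvergesTo-nat* (suc k) s→x = ConvergesTo-cong (λ n → expand _) (expand _)
    (ConvergesTo-+ s→x (ConvergesTo-nat* k s→x))
    where
    expand : ∀ x → x + natℝ k * x ≈ natℝ (suc k) * x
    expand x = solve 2 (λ k x → x :+ k :* x := (:1 :+ k) :* x) refl (natℝ k) x

  ConvergesTo-Σ< : ∀ m {s : ℕ → ℕ → ℝ} {x : ℕ → ℝ} → (∀ j → ConvergesTo (s j) (x j)) →
                   ConvergesTo (λ n → Σ< m (λ j → s j n)) (Σ< m x)
  ConvergesTo-Σ< zero    s→x = ConvergesTo-const 0#
  ConvergesTo-Σ< (suc m) s→x = ConvergesTo-+ (s→x 0) (ConvergesTo-Σ< m (s→x ∘ suc))

  error⇒ConvergesTo : ∀ {s x} K → (∀ N → Bounded (K * step N) (s N - x)) → ConvergesTo s x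
  error⇒ConvergesTo K error ε 0<ε =
    let N₀ , small = small-multiple K ε 0<ε
    in N₀ , λ N N₀≤N → Bounded-weaken (small N N₀≤N) (error N)

  -- Riemann sums over uniform partitions of [0, 1]

  riemann : (ℝ → ℝ) → ℕ → ℝ
  riemann f N = Σ< (suc N) (λ i → f (natℝ i /ℕ suc N) * step N)

  riemann-cong : ∀ {f g} → (∀ t → f t ≈ g t) → ∀ N → riemann f N ≈ riemann g N
  riemann-cong {f} f≈g N = Σ<-cong (suc N) {λ i → f (natℝ i /ℕ suc N) * step N} (λ i → *-congʳ (f≈g _))

  riemann-*ˡ : ∀ x f N → x * riemann f N ≈ riemann (λ t → x * f t) N
  riemann-*ˡ x f N = trans (Σ<-*ˡ (suc N) x (λ i → f (natℝ i /ℕ suc N) * step N))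
    (Σ<-cong (suc N) {λ i → x * (f (natℝ i /ℕ suc N) * step N)} (λ i → sym (*-assoc _ _ _)))

  uniformPartition : ∀ N → TaggedPartition 0# 1# (suc N)
  uniformPartition N = record
    { point  = λ i → natℝ (toℕ i) /ℕ suc N
    ; tag    = λ i → natℝ (toℕ i) /ℕ suc N
    ; start  = zeroˡ _
    ; end    = trans (*-congʳ (×-congˡ (toℕ-fromℕ (suc N)))) (nat*step≈1 N)
    ; left≤  = λ i → irrefl (*-congʳ (×-congˡ (≡.sym (toℕ-inject₁ i))))
    ; ≤right = λ i → λ next<this → irrefl refl (<-trans next<this (0<d⇒x<y (0<step N)
        (solve 2 (λ n h → h := (:1 :+ n) :* h :- n :* h) refl (natℝ (toℕ i)) (step N))))
    }

  width-uniformPartition : ∀ N i → TaggedPartition.width (uniformPartition N) i ≈ step N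
  width-uniformPartition N i =
    trans (+-congˡ (-‿cong (*-congʳ (×-congˡ (toℕ-inject₁ i)))))
      (solve 2 (λ n h → (:1 :+ n) :* h :- n :* h := h) refl (natℝ (toℕ i)) (step N))

  -- Restricting the limit over all tagged partitions to uniform ones yields a sequence, to which
  -- uniqueness of limits applies.
  IsIntegral⇒ConvergesTo : ∀ {f I} → IsIntegral f 0# 1# I → ConvergesTo (riemann f) I
  IsIntegral⇒ConvergesTo {f} ∫f ε 0<ε =
    let δ , 0<δ , close = ∫f ε 0<ε
        N₀ , fine = small-multiple 1# δ 0<δ
    in N₀ , λ N N₀≤N → Bounded-cong refl
      (+-congʳ (sum-cong-≋ {suc N}
        {λ i → f (natℝ (toℕ i) /ℕ suc N) * TaggedPartition.width (uniformPartition N) i}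
        (λ i → *-congˡ (width-uniformPartition N i))))
      (close (uniformPartition N) (λ i →
        <-respˡ-≈ (trans (*-identityˡ _) (sym (width-uniformPartition N i))) (fine N N₀≤N)))

  -- Integrals of powers and falling factorials

  Σ<-telescope : ∀ n (G : ℕ → ℝ) → Σ< n (λ i → G (suc i) - G i) ≈ G n - G 0
  Σ<-telescope zero    G = sym (-‿inverseʳ (G 0))
  Σ<-telescope (suc n) G = trans (+-congˡ (Σ<-telescope n (G ∘ suc)))
    (solve 3 (λ p q r → (q :- p) :+ (r :- q) := r :- p) refl (G 0) (G 1) (G (suc n)))

  Bounded-Σ< : ∀ n {b} (f : ℕ → ℝ) → (∀ i → i ℕ.≤ n → Bounded b (f i)) →
               Bounded (natℝ (suc n) * b) (Σ< (suc n) f)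
  Bounded-Σ< zero    {b} f bf = Bounded-cong
    (solve 1 (λ b → b := (:1 :+ :0) :* b) refl b) (sym (+-identityʳ _)) (bf 0 z≤n)
  Bounded-Σ< (suc n) {b} f bf = Bounded-cong
    (solve 2 (λ b n → b :+ n :* b := (:1 :+ n) :* b) refl b (natℝ (suc n))) refl
    (Bounded-+ (bf 0 z≤n) (Bounded-Σ< n (f ∘ suc) (λ i i≤n → bf (suc i) (s≤s i≤n))))

  ^-bounded : ∀ b k → ∃[ K ] (∀ x → Bounded b x → Bounded K (x ^ k))
  ^-bounded b zero    = proj₁ (bounded 1#) , λ _ _ → proj₂ (bounded 1#)
  ^-bounded b (suc k) =
    let K , p = ^-bounded b k
    in b * K , λ x bx → Bounded-* bx (p x bx)

  -- The cofactor of d^2 in the Taylor expansion of (x + d)^(k+1); the recursion comes from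
  -- multiplying the previous expansion by x + d.
  remainder : ℕ → ℝ → ℝ → ℝ
  remainder zero    x d = 0#
  remainder (suc k) x d = natℝ (suc k) * x ^ k + (x + d) * remainder k x d

  ^-taylor : ∀ k x d →
    (x + d) ^ suc k ≈ x ^ suc k + (natℝ (suc k) * (d * x ^ k) + d * d * remainder k x d)
  ^-taylor zero    x d = solve 2 (λ x d →
    (x :+ d) :* :1 := x :* :1 :+ ((:1 :+ :0) :* (d :* :1) :+ d :* d :* :0)) refl x d
  ^-taylor (suc k) x d = trans (*-congˡ (^-taylor k x d))
    (solve 5 (λ x d n p r →
        (x :+ d) :* (x :* p :+ (n :* (d :* p) :+ d :* d :* r))
        := x :* (x :* p) :+ ((:1 :+ n) :* (d :* (x :* p)) :+ d :* d :* (n :* p :+ (x :+ d) :* r)))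
      refl x d (natℝ (suc k)) (x ^ k) (remainder k x d))

  remainder-bounded : ∀ b k →
    ∃[ K ] (∀ x d → Bounded b x → Bounded b (x + d) → Bounded K (remainder k x d))
  remainder-bounded b zero    = 1# , λ _ _ _ _ → Bounded-0 0<1
  remainder-bounded b (suc k) =
    let K , p = ^-bounded b k
        L , q = remainder-bounded b k
        M , r = bounded (natℝ (suc k))
    in M * K + b * L , λ x d bx bx+d →
         Bounded-+ (Bounded-* r (p x bx)) (Bounded-* bx+d (q x d bx bx+d))

  -- The nodes lie in [0, 1], and the strict bound 2 leaves room at both ends. The upper estimate is
  -- the lower one at the reflected node N + 1 - i.
  node-bounded : ∀ N i → i ℕ.≤ suc N → Bounded (1# + 1#) (natℝ i /ℕ suc N)
  node-bounded N i i≤n = Bounded-from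
    (<-respʳ-≈ (sym (+-assoc 1# 1# _)) (0<x+y 0<1 (0<1+node i)))
    (<-respʳ-≈ reflect (0<1+node (suc N ∸ i)))
    where
    0<1+node : ∀ j → 0# < 1# + natℝ j /ℕ suc N
    0<1+node zero    = <-respʳ-≈ (sym (trans (+-congˡ (zeroˡ _)) (+-identityʳ 1#))) 0<1
    0<1+node (suc j) = 0<x+y 0<1 (*-pos (0<natℝ-suc j) (0<step N))
    complement : natℝ (suc N ∸ i) /ℕ suc N + natℝ i /ℕ suc N ≈ 1#
    complement = trans (sym (distribʳ _ _ _)) (trans
      (*-congʳ (trans (sym (×-homo-+ 1# (suc N ∸ i) i)) (×-congˡ (ℕ.m∸n+n≡m i≤n)))) (nat*step≈1 N))
    reflect : 1# + natℝ (suc N ∸ i) /ℕ suc N ≈ (1# + 1#) - natℝ i /ℕ suc N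
    reflect = trans (solve 2 (λ p q → :1 :+ p := (:1 :+ (p :+ q)) :- q) refl _ (natℝ i /ℕ suc N))
      (+-congʳ (+-congˡ complement))

  -- Treats both kinds at once: t - x is w + e t with e = 1 and w = - x, and x - t is w + e t with e
  -- = - 1 and w = x.
  module SignedShift (e w : ℝ) (e*e≈1 : e * e ≈ 1#) where

    node : ℕ → ℕ → ℝ
    node N i = w + e * (natℝ i /ℕ suc N)

    node-suc : ∀ N i → node N i + e * step N ≈ node N (suc i)
    node-suc N i = solve 4 (λ w e n h → (w :+ e :* (n :* h)) :+ e :* h := w :+ e :* ((:1 :+ n) :* h))
      refl w e (natℝ i) (step N)

    radius : ℝ
    radius = proj₁ (bounded w) + proj₁ (bounded e) * (1# + 1#)

    node-in-radius : ∀ N i → i ℕ.≤ suc N → Bounded radius (node N i)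
    node-in-radius N i i≤n =
      Bounded-+ (proj₂ (bounded w)) (Bounded-* (proj₂ (bounded e)) (node-bounded N i i≤n))

    -- The summand is e times an increment of (w + e t)^(k+1), up to a second order error.
    nat*riemann-^ : ∀ k N →
      natℝ (suc k) * riemann (λ t → (w + e * t) ^ k) N ≈
        e * ((w + e) ^ suc k - w ^ suc k) +
        Σ< (suc N) (λ i → step N * (step N * - (e * remainder k (node N i) (e * step N))))
    nat*riemann-^ k N = begin
      natℝ (suc k) * Σ< (suc N) (λ i → node N i ^ k * h)
        ≈⟨ Σ<-*ˡ (suc N) (natℝ (suc k)) (λ i → node N i ^ k * h) ⟩
      Σ< (suc N) (λ i → natℝ (suc k) * (node N i ^ k * h))
        ≈⟨ Σ<-cong (suc N) summand ⟩
      Σ< (suc N) (λ i → e * (G (suc i) - G i) + error i)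
        ≈⟨ Σ<-distrib-+ (suc N) (λ i → e * (G (suc i) - G i)) error ⟩
      Σ< (suc N) (λ i → e * (G (suc i) - G i)) + Σ< (suc N) error
        ≈⟨ +-congʳ (Σ<-*ˡ (suc N) e (λ i → G (suc i) - G i)) ⟨
      e * Σ< (suc N) (λ i → G (suc i) - G i) + Σ< (suc N) error
        ≈⟨ +-congʳ (*-congˡ (trans (Σ<-telescope (suc N) G) (+-cong (^-congˡ (suc k) lastNode)
             (-‿cong (^-congˡ (suc k) firstNode))))) ⟩
      e * ((w + e) ^ suc k - w ^ suc k) + Σ< (suc N) error
        ∎
      where
      h = step N
      G error : ℕ → ℝ
      G i = node N i ^ suc k
      error i = h * (h * - (e * remainder k (node N i) (e * h)))
      firstNode : node N 0 ≈ w
      firstNode = solve 3 (λ w e h → w :+ e :* (:0 :* h) := w) refl w e h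
      lastNode : node N (suc N) ≈ w + e
      lastNode = +-congˡ (trans (*-congˡ (nat*step≈1 N)) (*-identityʳ e))
      summand : ∀ i → natℝ (suc k) * (node N i ^ k * h) ≈ e * (G (suc i) - G i) + error i
      summand i = begin
        natℝ (suc k) * (p * h)
          -- Inserting e * e = 1 exposes the linear Taylor term, whose increment is e h rather than
          -- h.
          ≈⟨ trans (*-congʳ (*-congʳ e*e≈1)) (*-congʳ (*-identityˡ _)) ⟨
        e * e * natℝ (suc k) * (p * h)
          ≈⟨ solve 6 (λ e n p h g r →
               e :* e :* n :* (p :* h)
               := e :* ((g :+ (n :* (e :* h :* p) :+ (e :* h) :* (e :* h) :* r)) :- g)
                  :- (e :* e) :* (e :* (h :* (h :* r)))) refl e (natℝ (suc k)) p h (G i) r ⟩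
        e * ((G i + (natℝ (suc k) * (e * h * p) + (e * h) * (e * h) * r)) - G i)
          - (e * e) * (e * (h * (h * r)))
          ≈⟨ +-cong
               (*-congˡ (+-congʳ (trans (sym (^-taylor k (node N i) (e * h))) (^-congˡ (suc k) (node-suc N i)))))
               (-‿cong (trans (*-congʳ e*e≈1) (*-identityˡ _))) ⟩
        e * (G (suc i) - G i) - e * (h * (h * r))
          ≈⟨ +-congˡ (solve 3 (λ e h r → :- (e :* (h :* (h :* r))) := h :* (h :* (:- (e :* r)))) refl e h r) ⟩
        e * (G (suc i) - G i) + error i
          ∎
        where
        p = node N i ^ k
        r = remainder k (node N i) (e * h)

    -- The `suc N` errors, each below h (h K), add up to less than K h because (N + 1) h = 1.
    ^-converges : ∀ k → ConvergesTo (λ N → natℝ (suc k) * riemann (λ t → (w + e * t) ^ k) N)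
                                    (e * ((w + e) ^ suc k - w ^ suc k))
    ^-converges k = error⇒ConvergesTo K (λ N → Bounded-cong (scale N) (difference N)
        (Bounded-Σ< N _ (λ i i≤N → Bounded-scale (0<step N) (Bounded-scale (0<step N)
          (Bounded-neg (Bounded-* (proj₂ (bounded e)) (proj₂ (remainder-bounded radius k) _ _
            (node-in-radius N i (ℕ.m≤n⇒m≤1+n i≤N))
            (Bounded-cong refl (sym (node-suc N i)) (node-in-radius N (suc i) (s≤s i≤N))))))))))
      where
      K : ℝ
      K = proj₁ (bounded e) * proj₁ (remainder-bounded radius k)
      scale : ∀ N → natℝ (suc N) * (step N * (step N * K)) ≈ K * step N
      scale N = begin
        natℝ (suc N) * (step N * (step N * K))
          ≈⟨ solve 3 (λ n h k → n :* (h :* (h :* k)) := (n :* h) :* (k :* h)) refl _ _ _ ⟩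
        (natℝ (suc N) * step N) * (K * step N)
          ≈⟨ trans (*-congʳ (nat*step≈1 N)) (*-identityˡ _) ⟩
        K * step N ∎
      difference : ∀ N →
        Σ< (suc N) (λ i → step N * (step N * - (e * remainder k (node N i) (e * step N)))) ≈
        natℝ (suc k) * riemann (λ t → (w + e * t) ^ k) N - e * ((w + e) ^ suc k - w ^ suc k)
      difference N = sym (trans (+-congʳ (nat*riemann-^ k N)) (solve 2 (λ p q → (p :+ q) :- p := q) refl _ _))

    -- Both sides are limits of one sequence: after exchanging the finite sums, the falling
    -- factorials at each node recombine into a power of that node.
    moments-of-limits : (x : ℕ → ℝ) →
      (∀ j → ConvergesTo (riemann (λ t → fallingFactorial (w + e * t) j)) (x j)) →
      ∀ k → natℝ (suc k) * moment x k ≈ e * ((w + e) ^ suc k - w ^ suc k)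
    moments-of-limits x lim k = ConvergesTo-unique
      (ConvergesTo-nat* (suc k) (ConvergesTo-Σ< (suc k) (λ j → ConvergesTo-nat* (stirling₂ k j) (lim j))))
      (ConvergesTo-cong (λ N → *-congˡ (sym (moment-riemann N))) refl (^-converges k))
      where
      f : ℕ → ℝ → ℝ
      f j t = fallingFactorial (w + e * t) j
      moment-riemann : ∀ N → moment (λ j → riemann (f j) N) k ≈ riemann (λ t → (w + e * t) ^ k) N
      moment-riemann N = begin
        Σ< (suc k) (λ j → stirling j k * riemann (f j) N)
          ≈⟨ Σ<-cong (suc k) (λ j → Σ<-*ˡ (suc N) (stirling j k) (λ i → f j (t i) * step N)) ⟩
        Σ< (suc k) (λ j → Σ< (suc N) (λ i → stirling j k * (f j (t i) * step N)))
          ≈⟨ ∑-comm {suc k} {suc N} (λ j i → stirling (toℕ j) k * (f (toℕ j) (t (toℕ i)) * step N)) ⟩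
        Σ< (suc N) (λ i → Σ< (suc k) (λ j → stirling j k * (f j (t i) * step N)))
          ≈⟨ Σ<-cong (suc N) inner ⟩
        Σ< (suc N) (λ i → node N i ^ k * step N)
          ∎
        where
        t : ℕ → ℝ
        t i = natℝ i /ℕ suc N
        inner : ∀ i → Σ< (suc k) (λ j → stirling j k * (f j (t i) * step N)) ≈ node N i ^ k * step N
        inner i = begin
          Σ< (suc k) (λ j → stirling j k * (f j (t i) * step N))
            ≈⟨ Σ<-cong (suc k) {g = λ j → stirling j k * f j (t i) * step N} (λ j → sym (*-assoc _ _ _)) ⟩
          Σ< (suc k) (λ j → stirling j k * f j (t i) * step N)
            ≈⟨ Σ<-*ʳ (suc k) (step N) (λ j → stirling j k * f j (t i)) ⟨
          moment (λ j → f j (t i)) k * step N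
            ≈⟨ *-congʳ (moment-fallingFactorial (node N i) (λ j → f j (t i)) refl (λ _ → refl) k) ⟩
          node N i ^ k * step N
            ∎

-- Moments of Cauchy polynomials and Bernoulli polynomials

module CauchyBernoulli {a ℓ₁ ℓ₂ ℓ₃ : Level} (R : RealField a ℓ₁ ℓ₂ ℓ₃) where

  open Real R
  open CommutativeRing commutativeRing
    using ( refl; sym; trans; setoid; semiring; +-cong; +-congˡ; +-congʳ; *-cong; *-congˡ; *-congʳ
          ; -‿cong; -‿inverseʳ; +-comm; *-assoc; +-identityʳ; *-identityˡ; *-identityʳ; zeroˡ; zeroʳ)
  open Algebra.Properties.Semiring.Exp semiring using (^-congˡ)
  open Algebra.Properties.Semiring.Mult semiring using (×-congˡ; ×1-homo-*)
  open IntegerCoefficients commutativeRing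
  open HurwitzProduct commutativeRing
  open RiemannSums R
  open import Relation.Binary.Reasoning.Setoid setoid

  -- Umbrally, e^{xt} is (e^{(w+1)t} - e^{wt}) / t.
  HasMoments : ℝ → (ℕ → ℝ) → Set ℓ₁
  HasMoments w x = ∀ n → (τ ⋆ moment x) n ≈ (e-1 ⋆ (w ^_)) n

  hasMoments : ∀ {w} x → (∀ k → natℝ (suc k) * moment x k ≈ (1# + w) ^ suc k - w ^ suc k) →
               HasMoments w x
  hasMoments {w} x p zero    = solve 2 (λ m u → :0 :* m := (:1 :- :1) :* u) refl (moment x 0) (w ^ 0)
  hasMoments {w} x p (suc k) = begin
    (τ ⋆ moment x) (suc k)                                ≈⟨ τ-⋆ k (moment x) ⟩
    natℝ (suc k) * moment x k                             ≈⟨ p k ⟩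
    (1# + w) ^ suc k - w ^ suc k                          ≈⟨ +-congʳ (e-1-⋆-^ (suc k) w) ⟨
    ((e-1 ⋆ (w ^_)) (suc k) + w ^ suc k) - w ^ suc k      ≈⟨ solve 2 (λ p q → (p :+ q) :- q := p) refl _ _ ⟩
    (e-1 ⋆ (w ^_)) (suc k)                                ∎

  -- Multiplying by e^{yt} translates z to y + z, hence w to y + w.
  HasMoments-⋆-^ : ∀ {w} x → HasMoments w x → ∀ y n →
    (τ ⋆ ((y ^_) ⋆ moment x)) n ≈ (e-1 ⋆ ((y + w) ^_)) n
  HasMoments-⋆-^ {w} x hm y n = begin
    (τ ⋆ ((y ^_) ⋆ moment x)) n     ≈⟨ ⋆-congˡ n τ (λ k → ⋆-comm k (y ^_) (moment x)) ⟩
    (τ ⋆ (moment x ⋆ (y ^_))) n     ≈⟨ ⋆-assoc n τ (moment x) (y ^_) ⟨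
    (τ ⋆ moment x ⋆ (y ^_)) n       ≈⟨ ⋆-congʳ n (y ^_) hm ⟩
    (e-1 ⋆ (w ^_) ⋆ (y ^_)) n       ≈⟨ ⋆-assoc n e-1 (w ^_) (y ^_) ⟩
    (e-1 ⋆ ((w ^_) ⋆ (y ^_))) n     ≈⟨ ⋆-congˡ n e-1 (λ k → trans (⋆-comm k (w ^_) (y ^_)) (^-⋆-^ k y w)) ⟩
    (e-1 ⋆ ((y + w) ^_)) n          ∎

  -- The normalisation L(1) = 1, read off at the coefficient of t.
  HasMoments-0 : ∀ {w} x → HasMoments w x → x 0 ≈ 1#
  HasMoments-0 {w} x hm = begin
    x 0                              ≈⟨ solve 1 (λ x → x := (:1 :+ :0) :* ((:1 :+ :0) :* x :+ :0)) refl (x 0) ⟩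
    natℝ 1 * moment x 0              ≈⟨ τ-⋆ 0 (moment x) ⟨
    (τ ⋆ moment x) 1                 ≈⟨ hm 1 ⟩
    (e-1 ⋆ (w ^_)) 1                 ≈⟨ solve 1 (λ w →
                                          (:1 :* :1 :- :0) :* :1 :+ (:1 :- :1) :* (w :* :1) := :1) refl w ⟩
    1#                               ∎

  fallingFactorial-cong : ∀ {y z} n → y ≈ z → fallingFactorial y n ≈ fallingFactorial z n
  fallingFactorial-cong zero    y≈z = refl
  fallingFactorial-cong (suc n) y≈z = *-cong (fallingFactorial-cong n y≈z) (+-congʳ y≈z)

  -- The factor n! clears the denominator of `binom`; `g` is the argument rewritten as w + e t.
  cauchy-limit : ∀ n (f g : ℝ → ℝ) {I c} → (∀ t → f t ≈ g t) → IsIntegral (λ t → binom (f t) n) 0# 1# I →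
                 c ≈ natℝ (n !) * I → ConvergesTo (riemann (λ t → fallingFactorial (g t) n)) c
  cauchy-limit n f g f≈g ∫f c≈ = ConvergesTo-cong
    (λ N → trans (riemann-*ˡ (natℝ (n !)) (λ t → binom (f t) n) N)
      (riemann-cong {λ t → natℝ (n !) * binom (f t) n} {λ t → fallingFactorial (g t) n}
        (λ t → trans (*-/ℕ (fallingFactorial (f t) n) (n !) {{n !≢0}}) (fallingFactorial-cong n (f≈g t))) N))
    (sym c≈) (ConvergesTo-nat* (n !) (IsIntegral⇒ConvergesTo {λ t → binom (f t) n} ∫f))

  cauchy₁-moments : ∀ {c} → AreCauchyPolynomials₁ c → ∀ x → HasMoments (- x) (λ m → c m x)
  cauchy₁-moments {c} isC x = hasMoments (λ m → c m x) λ k → begin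
    natℝ (suc k) * moment (λ m → c m x) k
      ≈⟨ moments-of-limits (λ m → c m x) (λ m → cauchy-limit m (_- x) (λ t → - x + 1# * t)
           (λ t → solve 2 (λ x t → t :- x := (:- x) :+ :1 :* t) refl x t)
           (proj₁ (proj₂ (isC m x))) (proj₂ (proj₂ (isC m x)))) k ⟩
    1# * ((- x + 1#) ^ suc k - (- x) ^ suc k)
      ≈⟨ trans (*-identityˡ _) (+-congʳ (^-congˡ (suc k) (+-comm (- x) 1#))) ⟩
    (1# - x) ^ suc k - (- x) ^ suc k
      ∎
    where open SignedShift 1# (- x) (*-identityˡ 1#)

  -- As t runs over [0, 1], x - t descends from x to x - 1, so the lower end is x - 1; the factor e
  -- = - 1 puts the two ends back in order.
  cauchy₂-moments : ∀ {ĉ} → AreCauchyPolynomials₂ ĉ → ∀ x → HasMoments (x - 1#) (λ m → ĉ m x)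
  cauchy₂-moments {ĉ} isĈ x = hasMoments (λ m → ĉ m x) λ k → begin
    natℝ (suc k) * moment (λ m → ĉ m x) k
      ≈⟨ moments-of-limits (λ m → ĉ m x) (λ m → cauchy-limit m (λ t → x - t) (λ t → x + - 1# * t)
           (λ t → solve 2 (λ x t → x :- t := x :+ (:- :1) :* t) refl x t)
           (proj₁ (proj₂ (isĈ m x))) (proj₂ (proj₂ (isĈ m x)))) k ⟩
    - 1# * ((x - 1#) ^ suc k - x ^ suc k)
      ≈⟨ solve 2 (λ p q → (:- :1) :* (p :- q) := q :- p) refl _ _ ⟩
    x ^ suc k - (x - 1#) ^ suc k
      ≈⟨ +-congʳ (^-congˡ (suc k) (solve 1 (λ x → x := :1 :+ (x :- :1)) refl x)) ⟩
    (1# + (x - 1#)) ^ suc k - (x - 1#) ^ suc k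
      ∎
    where open SignedShift (- 1#) x (solve 0 ((:- :1) :* (:- :1) := :1) refl)

  -- The generating function is e^{xt} S_m. The defining sum stops at n - m, but the missing terms
  -- contain Stirling numbers that vanish.
  stirling₂ˣ≈⋆ : ∀ x n m → stirling₂ˣ x n m ≈ ((x ^_) ⋆ stirling m) n
  stirling₂ˣ≈⋆ x n m = begin
    Σ< (suc (n ∸ m)) t
      ≈⟨ Σ<-extend t (s≤s (ℕ.m∸n≤m n m)) vanishes ⟩
    Σ< (suc n) t
      ≈⟨ Σ<-cong (suc n) reorder ⟩
    Σ< (suc n) (λ i → natℝ (n C i) * (x ^ i * stirling m (n ∸ i)))
      ≈⟨ ⋆-binomial n (x ^_) (stirling m) ⟩
    ((x ^_) ⋆ stirling m) n
      ∎
    where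
    t : ℕ → ℝ
    t i = natℝ ((n C i) ℕ.* stirling₂ (n ∸ i) m) * x ^ i
    reorder : ∀ i → t i ≈ natℝ (n C i) * (x ^ i * stirling m (n ∸ i))
    reorder i = trans (*-congʳ (×1-homo-* (n C i) (stirling₂ (n ∸ i) m)))
      (solve 3 (λ p q r → (p :* q) :* r := p :* (r :* q)) refl (natℝ (n C i)) (stirling m (n ∸ i)) (x ^ i))
    n∸i<m : ∀ {i} → n ∸ m ℕ.< i → i ℕ.≤ n → n ∸ i ℕ.< m
    n∸i<m {i} n∸m<i i≤n = ℕ.+-cancelʳ-< i (n ∸ i) m (≡.subst (ℕ._< m ℕ.+ i) (≡.sym (ℕ.m∸n+n≡m i≤n))
      (ℕ.≤-<-trans (ℕ.m≤n+m∸n n m) (ℕ.+-monoʳ-< m n∸m<i)))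
    vanishes : ∀ i → suc (n ∸ m) ℕ.≤ i → i ℕ.< suc n → t i ≈ 0#
    vanishes i n∸m<i (s≤s i≤n) = trans
      (*-congʳ {y = 0#} (×-congˡ (≡.trans
        (≡.cong ((n C i) ℕ.*_) (stirling₂≡0 (n∸i<m n∸m<i i≤n))) (ℕ.*-zeroʳ (n C i)))))
      (zeroˡ _)

  -- Umbrally the sum is L((y + z)^M), the mean of s^M over the interval from y + w to y + w + 1.
  stirling₂ˣ-sum : ∀ {w} x → HasMoments w x → ∀ y M →
    natℝ (suc M) * Σ< (suc M) (λ l → stirling₂ˣ y M l * x l) ≈ (1# + (y + w)) ^ suc M - (y + w) ^ suc M
  stirling₂ˣ-sum {w} x hm y M = begin
    natℝ (suc M) * Σ< (suc M) (λ l → stirling₂ˣ y M l * x l)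
      ≈⟨ *-congˡ (Σ<-cong (suc M) {λ l → stirling₂ˣ y M l * x l} (λ l → *-congʳ (stirling₂ˣ≈⋆ y M l))) ⟩
    natℝ (suc M) * Σ< (suc M) (λ l → ((y ^_) ⋆ stirling l) M * x l)
      ≈⟨ *-congˡ (Σ<-moment M (y ^_) x) ⟩
    natℝ (suc M) * ((y ^_) ⋆ moment x) M
      ≈⟨ τ-⋆ M ((y ^_) ⋆ moment x) ⟨
    (τ ⋆ ((y ^_) ⋆ moment x)) (suc M)
      ≈⟨ HasMoments-⋆-^ x hm y (suc M) ⟩
    (e-1 ⋆ ((y + w) ^_)) (suc M)
      ≈⟨ solve 2 (λ p q → p := (p :+ q) :- q) refl _ ((y + w) ^ suc M) ⟩
    ((e-1 ⋆ ((y + w) ^_)) (suc M) + (y + w) ^ suc M) - (y + w) ^ suc M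
      ≈⟨ +-congʳ (e-1-⋆-^ (suc M) (y + w)) ⟩
    (1# + (y + w)) ^ suc M - (y + w) ^ suc M
      ∎

  egf-scaled : ∀ s k → natℝ (k !) * egf s k ≈ s k
  egf-scaled s k = *-/ℕ (s k) (k !) {{k !≢0}}

  𝟙-scaled : ∀ k → natℝ (k !) * 𝟙 k ≈ δ k
  𝟙-scaled zero    = solve 0 ((:1 :+ :0) :* :1 := :1) refl
  𝟙-scaled (suc k) = zeroʳ _

  𝕥-scaled : ∀ k → natℝ (k !) * 𝕥 k ≈ τ k
  𝕥-scaled zero          = zeroʳ _
  𝕥-scaled (suc zero)    = solve 0 ((:1 :+ :0) :* :1 := :1) refl
  𝕥-scaled (suc (suc k)) = zeroʳ _

  bernoulli-⋆ : ∀ {B} → AreBernoulliPolynomials B → ∀ x n → (τ ⋆ (x ^_)) n ≈ (e-1 ⋆ (λ k → B k x)) n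
  bernoulli-⋆ {B} isB x n = begin
    (τ ⋆ (x ^_)) n
      ≈⟨ ⋆-convolution n 𝕥 (exp x) τ (x ^_) 𝕥-scaled (egf-scaled (x ^_)) ⟨
    natℝ (n !) * (𝕥 ⊛ exp x) n
      ≈⟨ *-congˡ (isB x n) ⟩
    natℝ (n !) * ((exp 1# ⊖ 𝟙) ⊛ egf (λ k → B k x)) n
      ≈⟨ ⋆-convolution n (exp 1# ⊖ 𝟙) (egf (λ k → B k x)) e-1 (λ k → B k x)
           (λ k → trans (solve 3 (λ n p q → n :* (p :- q) := n :* p :- n :* q) refl (natℝ (k !)) (exp 1# k) (𝟙 k))
                        (+-cong (egf-scaled (1# ^_) k) (-‿cong (𝟙-scaled k))))
           (egf-scaled (λ k → B k x)) ⟩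
    (e-1 ⋆ (λ k → B k x)) n
      ∎

  module _ {x : ℝ} (b : ℕ → ℝ) (generating : ∀ n → (τ ⋆ (x ^_)) n ≈ (e-1 ⋆ b) n) where

    -- `n` and `m` stand for n - 1 and m - 1 of the statement, hence the successors on the right.
    n*stirling₂ˣ : ∀ n m → natℝ (suc n) * stirling₂ˣ x n m ≈ natℝ (suc m) * (b ⋆ stirling (suc m)) (suc n)
    n*stirling₂ˣ n m = begin
      natℝ (suc n) * stirling₂ˣ x n m
        ≈⟨ *-congˡ (stirling₂ˣ≈⋆ x n m) ⟩
      natℝ (suc n) * ((x ^_) ⋆ stirling m) n
        ≈⟨ τ-⋆ n ((x ^_) ⋆ stirling m) ⟨
      (τ ⋆ ((x ^_) ⋆ stirling m)) (suc n)
        ≈⟨ ⋆-assoc (suc n) τ (x ^_) (stirling m) ⟨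
      (τ ⋆ (x ^_) ⋆ stirling m) (suc n)
        ≈⟨ ⋆-congʳ (suc n) (stirling m) (λ k → trans (generating k) (⋆-comm k e-1 b)) ⟩
      (b ⋆ e-1 ⋆ stirling m) (suc n)
        ≈⟨ ⋆-assoc (suc n) b e-1 (stirling m) ⟩
      (b ⋆ (e-1 ⋆ stirling m)) (suc n)
        ≈⟨ ⋆-congˡ (suc n) b (λ k → stirling-⋆ k m) ⟩
      (b ⋆ (λ k → natℝ (suc m) * stirling (suc m) k)) (suc n)
        ≈⟨ ⋆-scaleˡ (suc n) (natℝ (suc m)) b (stirling (suc m)) ⟩
      natℝ (suc m) * (b ⋆ stirling (suc m)) (suc n)
        ∎

    -- Multiplied by t, the left side becomes b (e^t - 1) e^{wt} = t e^{xt} e^{wt}, and t is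
    -- cancelled through coefficient `suc n`.
    bernoulli-⋆-moment : ∀ {w} u → HasMoments w u → ∀ n → (b ⋆ moment u) n ≈ (x + w) ^ n
    bernoulli-⋆-moment {w} u hm n = nat-cancelˡ n (begin
      natℝ (suc n) * (b ⋆ moment u) n           ≈⟨ τ-⋆ n (b ⋆ moment u) ⟨
      (τ ⋆ (b ⋆ moment u)) (suc n)              ≈⟨ ⋆-assoc (suc n) τ b (moment u) ⟨
      (τ ⋆ b ⋆ moment u) (suc n)                ≈⟨ ⋆-congʳ (suc n) (moment u) (λ k → ⋆-comm k τ b) ⟩
      (b ⋆ τ ⋆ moment u) (suc n)                ≈⟨ ⋆-assoc (suc n) b τ (moment u) ⟩
      (b ⋆ (τ ⋆ moment u)) (suc n)              ≈⟨ ⋆-congˡ (suc n) b hm ⟩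
      (b ⋆ (e-1 ⋆ (w ^_))) (suc n)              ≈⟨ ⋆-assoc (suc n) b e-1 (w ^_) ⟨
      (b ⋆ e-1 ⋆ (w ^_)) (suc n)                ≈⟨ ⋆-congʳ (suc n) (w ^_) (λ k →
                                                     trans (⋆-comm k b e-1) (sym (generating k))) ⟩
      (τ ⋆ (x ^_) ⋆ (w ^_)) (suc n)             ≈⟨ ⋆-assoc (suc n) τ (x ^_) (w ^_) ⟩
      (τ ⋆ ((x ^_) ⋆ (w ^_))) (suc n)           ≈⟨ ⋆-congˡ (suc n) τ (λ k → ^-⋆-^ k x w) ⟩
      (τ ⋆ ((x + w) ^_)) (suc n)                ≈⟨ τ-⋆ n ((x + w) ^_) ⟩
      natℝ (suc n) * (x + w) ^ n                ∎)

    bernoulli-⋆-stirling-0 : ∀ n → (b ⋆ stirling 0) n ≈ b n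
    bernoulli-⋆-stirling-0 n = trans (⋆-comm n b _)
      (trans (⋆-congʳ n b (λ { zero → +-identityʳ 1# ; (suc _) → refl })) (⋆-identityˡ n b))

    outer-sum : ∀ {w σ} u → HasMoments w u → (T : ℕ → ℝ) → (∀ i → natℝ (suc i) * T i ≈ σ) → ∀ n →
      natℝ (suc n) * Σ< (suc n) (λ i → stirling₂ˣ x n i * u (suc i) * T i) ≈ σ * ((x + w) ^ suc n - b (suc n))
    outer-sum {w} {σ} u hm T Tσ n = begin
      natℝ (suc n) * Σ< (suc n) (λ i → stirling₂ˣ x n i * u (suc i) * T i)
        ≈⟨ Σ<-*ˡ (suc n) (natℝ (suc n)) (λ i → stirling₂ˣ x n i * u (suc i) * T i) ⟩
      Σ< (suc n) (λ i → natℝ (suc n) * (stirling₂ˣ x n i * u (suc i) * T i))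
        ≈⟨ Σ<-cong (suc n) summand ⟩
      Σ< (suc n) (λ i → σ * v (suc i))
        ≈⟨ Σ<-*ˡ (suc n) σ (v ∘ suc) ⟨
      σ * Σ< (suc n) (v ∘ suc)
        -- The term m = 0 is added and subtracted, since only the complete sum is a moment.
        ≈⟨ *-congˡ (solve 2 (λ p q → p := (q :+ p) :- q) refl _ (v 0)) ⟩
      σ * (Σ< (suc (suc n)) v - v 0)
        ≈⟨ *-congˡ (+-cong (trans (Σ<-moment (suc n) b u) (bernoulli-⋆-moment u hm (suc n)))
             (-‿cong (trans (*-cong (bernoulli-⋆-stirling-0 (suc n)) (HasMoments-0 u hm)) (*-identityʳ _)))) ⟩
      σ * ((x + w) ^ suc n - b (suc n))
        ∎
      where
      v : ℕ → ℝ
      v j = (b ⋆ stirling j) (suc n) * u j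
      summand : ∀ i → natℝ (suc n) * (stirling₂ˣ x n i * u (suc i) * T i) ≈ σ * v (suc i)
      summand i = begin
        natℝ (suc n) * (stirling₂ˣ x n i * u (suc i) * T i)
          ≈⟨ solve 4 (λ n s u t → n :* (s :* u :* t) := (n :* s) :* (u :* t)) refl _ _ _ _ ⟩
        (natℝ (suc n) * stirling₂ˣ x n i) * (u (suc i) * T i)
          ≈⟨ *-congʳ (n*stirling₂ˣ n i) ⟩
        (natℝ (suc i) * (b ⋆ stirling (suc i)) (suc n)) * (u (suc i) * T i)
          ≈⟨ solve 4 (λ n s u t → (n :* s) :* (u :* t) := (n :* t) :* (s :* u)) refl _ _ _ _ ⟩
        (natℝ (suc i) * T i) * v (suc i)
          ≈⟨ *-congʳ (Tσ i) ⟩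
        σ * v (suc i)
          ∎

  -- Evaluation of the double sums

  -1^n*-1^n≈1 : ∀ n → -1^ n * -1^ n ≈ 1#
  -1^n*-1^n≈1 zero    = *-identityˡ 1#
  -1^n*-1^n≈1 (suc n) =
    trans (solve 1 (λ p → ((:- :1) :* p) :* ((:- :1) :* p) := p :* p) refl (-1^ n)) (-1^n*-1^n≈1 n)

  0^suc≈0 : ∀ {z} n → z ≈ 0# → z ^ suc n ≈ 0#
  0^suc≈0 n z≈0 = trans (*-congʳ z≈0) (zeroˡ _)

  ∑∑ ∑∑± : (x y : ℝ) (u v : ℕ → ℝ) → ℕ → ℝ
  ∑∑ x y u v n = ∑[1≤ m ≤ suc n ] ∑[1≤ l ≤ m ]
    (stirling₂ˣ x n (m ∸ 1) * stirling₂ˣ y (m ∸ 1) (l ∸ 1) * u m * v (l ∸ 1))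
  ∑∑± x y u v n = ∑[1≤ m ≤ suc n ] ∑[1≤ l ≤ m ]
    (-1^ m * (stirling₂ˣ x n (m ∸ 1) * stirling₂ˣ y (m ∸ 1) (l ∸ 1)) * u m * v (l ∸ 1))

  -- `u` is left open: each of its four instances, c or ĉ at two arguments, yields one identity for
  -- either kind of inner sum.
  module Sums {c ĉ B : ℕ → ℝ → ℝ} (isC : AreCauchyPolynomials₁ c) (isĈ : AreCauchyPolynomials₂ ĉ)
              (isB : AreBernoulliPolynomials B) (x y : ℝ) {w : ℝ} (u : ℕ → ℝ) (hm : HasMoments w u) where

    ∑∑-cauchy₁ : ∀ n → natℝ (suc n) * ∑∑ x y u (λ l → c l y) n ≈ (x + w) ^ suc n - B (suc n) x
    ∑∑-cauchy₁ n = begin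
      natℝ (suc n) * ∑∑ x y u (λ l → c l y) n
        ≈⟨ *-congˡ (Σ<-cong (suc n) factor) ⟩
      natℝ (suc n) * Σ< (suc n) (λ i → stirling₂ˣ x n i * u (suc i) * T i)
        ≈⟨ outer-sum (λ k → B k x) (bernoulli-⋆ isB x) u hm T weight n ⟩
      1# * ((x + w) ^ suc n - B (suc n) x)
        ≈⟨ *-identityˡ _ ⟩
      (x + w) ^ suc n - B (suc n) x
        ∎
      where
      T : ℕ → ℝ
      T i = Σ< (suc i) (λ l → stirling₂ˣ y i l * c l y)
      weight : ∀ i → natℝ (suc i) * T i ≈ 1#
      weight i = begin
        natℝ (suc i) * T i
          ≈⟨ stirling₂ˣ-sum (λ l → c l y) (cauchy₁-moments isC y) y i ⟩
        (1# + (y - y)) ^ suc i - (y - y) ^ suc i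
          ≈⟨ +-cong (^-congˡ (suc i) (trans (+-congˡ (-‿inverseʳ y)) (+-identityʳ 1#)))
                    (-‿cong (0^suc≈0 i (-‿inverseʳ y))) ⟩
        1# ^ suc i - 0#
          ≈⟨ +-congʳ (1^n≈1 (suc i)) ⟩
        1# - 0#
          ≈⟨ solve 0 (:1 :- :0 := :1) refl ⟩
        1#
          ∎
      factor : ∀ i → Σ< (suc i) (λ l → stirling₂ˣ x n i * stirling₂ˣ y i l * u (suc i) * c l y)
                     ≈ stirling₂ˣ x n i * u (suc i) * T i
      factor i = trans
        (Σ<-cong (suc i) {g = λ l → stirling₂ˣ x n i * u (suc i) * (stirling₂ˣ y i l * c l y)}
          (λ l → solve 4 (λ p q r s → p :* q :* r :* s := p :* r :* (q :* s)) refl _ _ _ _))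
        (sym (Σ<-*ˡ (suc i) _ (λ l → stirling₂ˣ y i l * c l y)))

    ∑∑-cauchy₂ : ∀ n → natℝ (suc n) * ∑∑± x y u (λ l → ĉ l (- y)) n ≈ B (suc n) x - (x + w) ^ suc n
    ∑∑-cauchy₂ n = begin
      natℝ (suc n) * ∑∑± x y u (λ l → ĉ l (- y)) n
        ≈⟨ *-congˡ (Σ<-cong (suc n) factor) ⟩
      natℝ (suc n) * Σ< (suc n) (λ i → stirling₂ˣ x n i * u (suc i) * (-1^ suc i * T i))
        ≈⟨ outer-sum (λ k → B k x) (bernoulli-⋆ isB x) u hm (λ i → -1^ suc i * T i) weight n ⟩
      - 1# * ((x + w) ^ suc n - B (suc n) x)
        ≈⟨ solve 2 (λ p q → (:- :1) :* (p :- q) := q :- p) refl _ _ ⟩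
      B (suc n) x - (x + w) ^ suc n
        ∎
      where
      T : ℕ → ℝ
      T i = Σ< (suc i) (λ l → stirling₂ˣ y i l * ĉ l (- y))
      weight : ∀ i → natℝ (suc i) * (-1^ suc i * T i) ≈ - 1#
      weight i = begin
        natℝ (suc i) * (s * T i)
          ≈⟨ solve 3 (λ n s t → n :* (s :* t) := s :* (n :* t)) refl (natℝ (suc i)) s (T i) ⟩
        s * (natℝ (suc i) * T i)
          ≈⟨ *-congˡ (stirling₂ˣ-sum (λ l → ĉ l (- y)) (cauchy₂-moments isĈ (- y)) y i) ⟩
        -- The bases reduce to 0 and - 1; the surviving power is `s` itself, so the outer sign
        -- squares it.
        s * ((1# + (y + (- y - 1#))) ^ suc i - (y + (- y - 1#)) ^ suc i)
          ≈⟨ *-congˡ (+-cong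
               (0^suc≈0 i (solve 1 (λ y → :1 :+ (y :+ ((:- y) :- :1)) := :0) refl y))
               (-‿cong (^-congˡ (suc i) (solve 1 (λ y → y :+ ((:- y) :- :1) := :- :1) refl y)))) ⟩
        s * (0# - s)
          ≈⟨ solve 1 (λ s → s :* (:0 :- s) := :- (s :* s)) refl s ⟩
        - (s * s)
          ≈⟨ -‿cong (-1^n*-1^n≈1 (suc i)) ⟩
        - 1#
          ∎
        where s = -1^ suc i
      factor : ∀ i → Σ< (suc i) (λ l → -1^ suc i * (stirling₂ˣ x n i * stirling₂ˣ y i l) * u (suc i) * ĉ l (- y))
                     ≈ stirling₂ˣ x n i * u (suc i) * (-1^ suc i * T i)
      factor i = trans
        (Σ<-cong (suc i) {g = λ l → stirling₂ˣ x n i * u (suc i) * -1^ suc i * (stirling₂ˣ y i l * ĉ l (- y))}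
          (λ l → solve 5 (λ e p q r s → e :* (p :* q) :* r :* s := p :* r :* e :* (q :* s)) refl _ _ _ _ _))
        (trans (sym (Σ<-*ˡ (suc i) _ (λ l → stirling₂ˣ y i l * ĉ l (- y)))) (*-assoc _ _ _))

  /ℕ-unique : ∀ n {s b} → natℝ (suc n) * s ≈ b → (b /ℕ suc n) ≈ s
  /ℕ-unique n {s} {b} eq = nat-cancelˡ n (trans (*-/ℕ b (suc n)) (sym eq))

proposition5 : ∀ {a ℓ₁ ℓ₂ ℓ₃} (R : RealField a ℓ₁ ℓ₂ ℓ₃) → let open Real R in
    (c ĉ B : ℕ → ℝ → ℝ) →
    AreCauchyPolynomials₁ c → AreCauchyPolynomials₂ ĉ → AreBernoulliPolynomials B →
    ∀ n .{{_ : NonZero n}} (x y : ℝ) →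
    let S : ℕ → ℕ → ℝ
        S m l = stirling₂ˣ x (n ∸ 1) (m ∸ 1) * stirling₂ˣ y (m ∸ 1) (l ∸ 1)
    in
      (- (B n x /ℕ n) ≈
        ∑[1≤ m ≤ n ] ∑[1≤ l ≤ m ] (S m l * c m x * c (l ∸ 1) y))
    × ((B n x /ℕ n) ≈
        ∑[1≤ m ≤ n ] ∑[1≤ l ≤ m ] (-1^ m * S m l * c m x * ĉ (l ∸ 1) (- y)))
    × (((-1^ n - B n x) /ℕ n) ≈
        ∑[1≤ m ≤ n ] ∑[1≤ l ≤ m ] (S m l * ĉ m (- x) * c (l ∸ 1) y))
    × (((B n x - -1^ n) /ℕ n) ≈
        ∑[1≤ m ≤ n ] ∑[1≤ l ≤ m ] (-1^ m * S m l * ĉ m (- x) * ĉ (l ∸ 1) (- y)))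
    × (B n x ≈
        (x ^ n) - (natℝ n * (∑[1≤ m ≤ n ] ∑[1≤ l ≤ m ] (S m l * c m 0# * c (l ∸ 1) y))))
    × (B n x ≈
        (x ^ n) + (natℝ n * (∑[1≤ m ≤ n ] ∑[1≤ l ≤ m ] (-1^ m * S m l * c m 0# * ĉ (l ∸ 1) (- y)))))
    × (B n x ≈
        ((x - 1#) ^ n) - (natℝ n * (∑[1≤ m ≤ n ] ∑[1≤ l ≤ m ] (S m l * ĉ m 0# * c (l ∸ 1) y))))
    × (B n x ≈
        ((x - 1#) ^ n) + (natℝ n * (∑[1≤ m ≤ n ] ∑[1≤ l ≤ m ] (-1^ m * S m l * ĉ m 0# * ĉ (l ∸ 1) (- y)))))
proposition5 R c ĉ B isC isĈ isB (suc n) x y =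
    trans (-‿/ℕ (B (suc n) x)) (/ℕ-unique n (trans (C.∑∑-cauchy₁ n)
      (trans (+-congʳ (0^suc≈0 n (-‿inverseʳ x))) (+-identityˡ _))))
  , /ℕ-unique n (trans (C.∑∑-cauchy₂ n)
      (trans (+-congˡ (-‿cong (0^suc≈0 n (-‿inverseʳ x)))) (solve 1 (λ b → b :- :0 := b) refl (B (suc n) x))))
  , /ℕ-unique n (trans (Ĉ.∑∑-cauchy₁ n) (+-congʳ (^-congˡ (suc n) x+[-x-1]≈-1)))
  , /ℕ-unique n (trans (Ĉ.∑∑-cauchy₂ n) (+-congˡ (-‿cong (^-congˡ (suc n) x+[-x-1]≈-1))))
  , isolate-minus (trans (C₀.∑∑-cauchy₁ n) (+-congʳ (^-congˡ (suc n) x-0≈x)))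
  , isolate-plus (trans (C₀.∑∑-cauchy₂ n) (+-congˡ (-‿cong (^-congˡ (suc n) x-0≈x))))
  , isolate-minus (trans (Ĉ₀.∑∑-cauchy₁ n) (+-congʳ (^-congˡ (suc n) x+[0-1]≈x-1)))
  , isolate-plus (trans (Ĉ₀.∑∑-cauchy₂ n) (+-congˡ (-‿cong (^-congˡ (suc n) x+[0-1]≈x-1))))
  where
  open Real R
  open CommutativeRing commutativeRing
    using (refl; sym; trans; semiring; +-congˡ; +-congʳ; +-identityˡ; -‿cong; -‿inverseʳ)
  open Algebra.Properties.Semiring.Exp semiring using (^-congˡ)
  open IntegerCoefficients commutativeRing
  open CauchyBernoulli R
  -- The bases x + w of these four instances are 0, - 1, x and x - 1; the power of 0 vanishes
  -- because the exponent is positive.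
  module C = Sums isC isĈ isB x y (λ m → c m x) (cauchy₁-moments isC x)
  module Ĉ = Sums isC isĈ isB x y (λ m → ĉ m (- x)) (cauchy₂-moments isĈ (- x))
  module C₀ = Sums isC isĈ isB x y (λ m → c m 0#) (cauchy₁-moments isC 0#)
  module Ĉ₀ = Sums isC isĈ isB x y (λ m → ĉ m 0#) (cauchy₂-moments isĈ 0#)
  -‿/ℕ : ∀ b → - (b /ℕ suc n) ≈ ((- b) /ℕ suc n)
  -‿/ℕ b = solve 2 (λ b i → :- (b :* i) := (:- b) :* i) refl b _
  x+[-x-1]≈-1 : x + (- x - 1#) ≈ - 1#
  x+[-x-1]≈-1 = solve 1 (λ x → x :+ ((:- x) :- :1) := :- :1) refl x
  x-0≈x : x - 0# ≈ x
  x-0≈x = solve 1 (λ x → x :- :0 := x) refl x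
  x+[0-1]≈x-1 : x + (0# - 1#) ≈ x - 1#
  x+[0-1]≈x-1 = solve 1 (λ x → x :+ (:0 :- :1) := x :- :1) refl x
  isolate-minus : ∀ {s p b} → s ≈ p - b → b ≈ p - s
  isolate-minus {s} {p} {b} eq = trans (solve 2 (λ p b → b := p :- (p :- b)) refl p b) (+-congˡ (-‿cong (sym eq)))
  isolate-plus : ∀ {s p b} → s ≈ b - p → b ≈ p + s
  isolate-plus {s} {p} {b} eq = trans (solve 2 (λ p b → b := p :+ (b :- p)) refl p b) (+-congˡ (sym eq))
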